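{- Let $\mathcal{C}$ be a class of graphs of bounded expansion and let $r\geq 2$ be an integer. Then the class $\{G^r\colon G\in \mathcal{C}\}$ of $r$th powers of graphs from $\mathcal{C}$ admits low rank-width colorings.
   Context: All graphs are finite, undirected and simple. The $r$th power $G^r$ of a graph $G$ has vertex set $V(G)$, with $u\neq v$ adjacent iff their distance in $G$ is at most $r$. A class $\mathcal{C}$ of graphs has bounded expansion if for every integer $r\ge 0$ there is a constant $c(r)$ such that every graph $H$ that is a depth-$r$ minor of a graph in $\mathcal{C}$ (i.e. obtained by contracting pairwise disjoint connected subgraphs of radius at most $r$ of a subgraph) satisfies $|E(H)|\le c(r)\,|V(H)|$. Rank-width: for a graph $G$ and $X\subseteq V(G)$, $\mathrm{cutrk}_G(X)$ is the rank over the binary field of the adjacency submatrix with rows $X$ and columns $V(G)\setminus X$ (zero if $X=\emptyset$ or $X=V(G)$). A rank-decomposition of $G$ is a pair $(T,L)$ with $T$ a tree with at least two nodes all of degree $1$ or $3$ and $L$ a bijection from $V(G)$ to the leaves of $T$; the width of an edge $e$ of $T$ is $\mathrm{cutrk}_G(A_e)$ where $A_e$ is the set of vertices mapped to the leaves of one component of $T-e$; the width of $(T,L)$ is the maximum width of its edges, and the rank-width of $G$ is the minimum width of a rank-decomposition (and $0$ if $|V(G)|\le 1$). A class $\mathcal{D}$ of graphs admits low rank-width colorings if there exist functions $N,Q\colon\mathbb{N}\to\mathbb{N}$ such that for all $p\in\mathbb{N}$, every $G\in\mathcal{D}$ can be vertex colored with at most $N(p)$ colors such that the union of any $i\le p$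 color classes induces a subgraph of rank-width at most $Q(i)$. -}

module Defs where

open import Data.Nat using (ℕ; zero; suc; _+_; _*_; _≤_; _<ᵇ_)
open import Data.Bool using (Bool; true; false; _∧_; _∨_; not; if_then_else_; _xor_)
open import Data.Bool.Properties using (∨-comm)
open import Data.Fin using (Fin; zero; suc; toℕ; inject₁; fromℕ; _≟_)
open import Data.Product using (Σ; ∃; _×_; _,_)
open import Data.Sum using (_⊎_)
open import Data.Empty using (⊥-elim)
open import Relation.Nullary using (¬_; yes; no)
open import Relation.Nullary.Decidable using (⌊_⌋)
open import Relation.Binary.PropositionalEquality using (_≡_; refl; sym; cong; cong₂)

record Graph : Set where
  field
    size   : ℕ
    adj    : Fin size → Fin size → Bool
    adjSym : ∀ u v → adj u v ≡ adj v u
    irrefl : ∀ u → adj u u ≡ false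
open Graph public

anyFin : ∀ {n} → (Fin n → Bool) → Bool
anyFin {zero}  f = false
anyFin {suc n} f = f zero ∨ anyFin (λ i → f (suc i))

countFin : ∀ {n} → (Fin n → Bool) → ℕ
countFin {zero}  f = 0
countFin {suc n} f = (if f zero then 1 else 0) + countFin (λ i → f (suc i))

sumFin : ∀ {n} → (Fin n → ℕ) → ℕ
sumFin {zero}  f = 0
sumFin {suc n} f = f zero + sumFin (λ i → f (suc i))

xorSum : ∀ {n} → (Fin n → Bool) → Bool
xorSum {zero}  f = false
xorSum {suc n} f = f zero xor xorSum (λ i → f (suc i))

eqFin : ∀ {n} → Fin n → Fin n → Bool
eqFin u v = ⌊ u ≟ v ⌋

eqFin-sym : ∀ {n} (u v : Fin n) → eqFin u v ≡ eqFin v u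
eqFin-sym u v with u ≟ v | v ≟ u
... | yes _ | yes _ = refl
... | no _  | no _  = refl
... | yes p | no q  = ⊥-elim (q (sym p))
... | no q  | yes p = ⊥-elim (q (sym p))

eqFin-refl : ∀ {n} (u : Fin n) → eqFin u u ≡ true
eqFin-refl u with u ≟ u
... | yes _ = refl
... | no q  = ⊥-elim (q refl)

reach : ∀ {n} → (Fin n → Fin n → Bool) → ℕ → Fin n → Fin n → Bool
reach A zero    u v = eqFin u v
reach A (suc k) u v = reach A k u v ∨ anyFin (λ w → A u w ∧ reach A k w v)

-- distance ≤ r in G (distance is symmetric; both orientations are
-- included only to make the symmetry proof of the power trivial)
distLe : (G : Graph) → ℕ → Fin (size G) → Fin (size G) → Bool
distLe G r u v = reach (adj G) r u v ∨ reach (adj G) r v u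

powerIrrefl : (G : Graph) (r : ℕ) (u : Fin (size G)) →
  (not (eqFin u u) ∧ distLe G r u u) ≡ false
powerIrrefl G r u rewrite eqFin-refl u = refl

power : ℕ → Graph → Graph
power r G = record
  { size   = size G
  ; adj    = λ u v → not (eqFin u v) ∧ distLe G r u v
  ; adjSym = λ u v → cong₂ _∧_ (cong not (eqFin-sym u v))
                               (∨-comm (reach (adj G) r u v) (reach (adj G) r v u))
  ; irrefl = powerIrrefl G r
  }

edgeCount : Graph → ℕ
edgeCount G = sumFin (λ i → countFin (λ j → adj G i j ∧ (toℕ i <ᵇ toℕ j)))

restrict : (G : Graph) → (Fin (size G) → Bool) → Fin (size G) → Fin (size G) → Bool
restrict G B x y = B x ∧ B y ∧ adj G x y

record DepthMinor (r : ℕ) (H G : Graph) : Set where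
  field
    branch   : Fin (size H) → Fin (size G) → Bool
    disjoint : ∀ v w x → branch v x ≡ true → branch w x ≡ true → v ≡ w
    radius   : ∀ v → Σ (Fin (size G)) λ c → (branch v c ≡ true) ×
                 (∀ x → branch v x ≡ true → reach (restrict G (branch v)) r c x ≡ true)
    edges    : ∀ u v → adj H u v ≡ true →
                 Σ (Fin (size G)) λ x → Σ (Fin (size G)) λ y →
                   (branch u x ≡ true) × (branch v y ≡ true) × (adj G x y ≡ true)

BoundedExpansion : (Graph → Set) → Set
BoundedExpansion C = ∀ (r : ℕ) → Σ ℕ λ c → ∀ (G H : Graph) → C G → DepthMinor r H G →
  edgeCount H ≤ c * size H

-- Cut-rank: cutrk_G(X) ≤ k, where cutrk is the GF(2)-rank of the
-- submatrix with rows X and columns V(G) ∖ X, i.e. the maximum number of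
-- linearly independent rows of that submatrix.

LinIndepRows : (G : Graph) (X : Fin (size G) → Set) {m : ℕ} → (Fin m → Fin (size G)) → Set
LinIndepRows G X {m} rows = ∀ (c : Fin m → Bool) →
  (∀ y → ¬ X y → xorSum (λ i → c i ∧ adj G (rows i) y) ≡ false) →
  ∀ i → c i ≡ false

CutRankLe : (G : Graph) → (Fin (size G) → Set) → ℕ → Set
CutRankLe G X k = ∀ (m : ℕ) (rows : Fin m → Fin (size G)) →
  (∀ i → X (rows i)) → LinIndepRows G X rows → m ≤ k

degree : (T : Graph) → Fin (size T) → ℕ
degree T t = countFin (adj T t)

Connected : Graph → Set
Connected T = ∀ u v → Σ ℕ λ k → reach (adj T) k u v ≡ true

IsCycle : (T : Graph) {k : ℕ} → (Fin (suc (suc (suc k))) → Fin (size T)) → Set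
IsCycle T {k} f =
  (∀ i j → f i ≡ f j → i ≡ j) ×
  (∀ (i : Fin (suc (suc k))) → adj T (f (inject₁ i)) (f (suc i)) ≡ true) ×
  (adj T (f (fromℕ (suc (suc k)))) (f zero) ≡ true)

Acyclic : Graph → Set
Acyclic T = ∀ (k : ℕ) (f : Fin (suc (suc (suc k))) → Fin (size T)) → ¬ IsCycle T f

IsTree : Graph → Set
IsTree T = Connected T × Acyclic T

deleteEdge : (T : Graph) → Fin (size T) → Fin (size T) → Fin (size T) → Fin (size T) → Bool
deleteEdge T a b u v = adj T u v ∧ not ((eqFin u a ∧ eqFin v b) ∨ (eqFin u b ∧ eqFin v a))

record RankDecomposition (G : Graph) : Set where
  field
    tree      : Graph
    isTree    : IsTree tree
    twoNodes  : 2 ≤ size tree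
    cubic     : ∀ t → (degree tree t ≡ 1) ⊎ (degree tree t ≡ 3)
    leafMap   : Fin (size G) → Fin (size tree)
    leafInj   : ∀ x y → leafMap x ≡ leafMap y → x ≡ y
    toLeaf    : ∀ x → degree tree (leafMap x) ≡ 1
    leafOnto  : ∀ t → degree tree t ≡ 1 → Σ (Fin (size G)) λ x → leafMap x ≡ t
open RankDecomposition public

sideOf : {G : Graph} (D : RankDecomposition G) → Fin (size (tree D)) → Fin (size (tree D)) →
  Fin (size G) → Set
sideOf D a b x = Σ ℕ λ k → reach (deleteEdge (tree D) a b) k a (leafMap D x) ≡ true

WidthLe : {G : Graph} → RankDecomposition G → ℕ → Set
WidthLe {G} D k = ∀ a b → adj (tree D) a b ≡ true → CutRankLe G (sideOf D a b) k

-- rank-width(G) ≤ k  (rank-width is 0 when |V(G)| ≤ 1)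
RankWidthLe : Graph → ℕ → Set
RankWidthLe G k = (size G ≤ 1) ⊎ Σ (RankDecomposition G) λ D → WidthLe D k

record InducedBy (G : Graph) (P : Fin (size G) → Set) (H : Graph) : Set where
  field
    emb     : Fin (size H) → Fin (size G)
    embInj  : ∀ u w → emb u ≡ emb w → u ≡ w
    embIn   : ∀ u → P (emb u)
    embOnto : ∀ v → P v → Σ (Fin (size H)) λ u → emb u ≡ v
    embAdj  : ∀ u w → adj H u w ≡ adj G (emb u) (emb w)

LowRankWidthColorings : (Graph → Set) → Set
LowRankWidthColorings D =
  Σ (ℕ → ℕ) λ N → Σ (ℕ → ℕ) λ Q → ∀ (p : ℕ) (G : Graph) → D G →
    Σ (Fin (size G) → Fin (N p)) λ col →
      ∀ (i : ℕ) → i ≤ p →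
      ∀ (cs : Fin i → Fin (N p)) → (∀ j j' → cs j ≡ cs j' → j ≡ j') →
      ∀ (H : Graph) → InducedBy G (λ v → Σ (Fin i) λ j → cs j ≡ col v) H →
      RankWidthLe H (Q i)

Powers : ℕ → (Graph → Set) → Graph → Set
Powers r C H = Σ Graph λ G → C G × (H ≡ power r G)

{-# OPTIONS --safe #-}
-- Removing vertices one at a time, each shielded from the remaining ones by a bounded set, yields
-- orders with bounded weak k-colouring numbers: were no remaining vertex shielded, a maximal packing
-- of short disjoint paths between the remaining vertices would give a too dense shallow minor.
-- A colouring χ that distinguishes weakly 2^q-reachable pairs of vertices makes every union Y of q
-- classes induce a subgraph with an elimination forest of depth at most q, because a path with 2^q
-- vertices has more than q colours.  Colour u in the power by the χ-colours of all vertices on short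
-- walks from u to the vertices weakly r-reachable from it: p such classes X lie in a union Y of
-- boundedly many χ-classes that contains a shortest path for each pair of X at distance at most r.
-- List X in preorder of the elimination forest of Y.  Every prefix is separated from the rest by the
-- ancestors of a single vertex, so rows with equal distances to them coincide in the adjacency
-- matrix of the power, and the caterpillar with this leaf order is a rank-decomposition of
-- bounded width.

module Submission where

open import Defs
open import Data.Nat using (ℕ; zero; suc; _+_; _*_; _∸_; _^_; _≤_; _<_; _≤ᵇ_; _<ᵇ_; z≤n; s≤s)
import Data.Nat as ℕ
open import Data.Nat.Properties hiding (_≟_)
open import Data.Nat.Tactic.RingSolver using (solve-∀)
open import Data.Bool using (Bool; T; true; false; _∧_; _∨_; not; if_then_else_; _xor_)
import Data.Bool.Properties as Bool
open import Data.Fin using (Fin; zero; suc; toℕ; fromℕ; fromℕ<; inject₁; lower₁; inject≤; _≟_; remQuot; combine; funToFin; finToFun; punchIn; punchOut)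
import Data.Fin.Properties as Fin
open import Data.Product using (Σ; Σ-syntax; _×_; _,_; proj₁; proj₂)
open import Data.Sum using (_⊎_; inj₁; inj₂; [_,_]′)
open import Data.Empty using (⊥; ⊥-elim)
open import Data.Unit using (⊤; tt)
open import Function using (_∘_; id)
open import Relation.Nullary using (¬_; Dec; yes; no)
open import Relation.Nullary.Decidable using (¬?; _×-dec_)
open import Relation.Binary.Definitions using (tri<; tri≈; tri>)
open import Relation.Binary.PropositionalEquality

-- Booleans

-- Powers of sparse graphs can be dense: the square of a star is complete. So no tree-depth bound
-- can be sought in the power itself; all structure is found in `G`, and the power enters only
-- through the number of distance types. Two orders of `G` are used, and their sequence matters. The
-- order for distance `r` fixes the size `D` of the closures; only then is `q = p * D` known, and
-- with it the distance `2 ^ q` for which the second order must be good. The colours record paths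
-- and not only vertices because a short connection of `u` and `v` that leaves `Y` could avoid the
-- ancestors that are meant to separate them. The rank bound for a union of `i` classes may depend
-- on `i` alone, whereas the number of colours may depend on `p`. Hence the colouring for `p` is the
-- product of the colourings built for 0 up to `p`, and a union of `i` classes is judged by
-- coordinate `i`.

∧-split : ∀ {a b} → a ∧ b ≡ true → a ≡ true × b ≡ true
∧-split {true} {true} _ = refl , refl

∧-join : ∀ {a b} → a ≡ true → b ≡ true → a ∧ b ≡ true
∧-join refl refl = refl

∨-split : ∀ {a b} → a ∨ b ≡ true → a ≡ true ⊎ b ≡ true
∨-split {true}  _ = inj₁ refl
∨-split {false} p = inj₂ p

∨-inl : ∀ {a b} → a ≡ true → a ∨ b ≡ true
∨-inl refl = refl

∨-inr : ∀ {a b} → b ≡ true → a ∨ b ≡ true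
∨-inr {true}  _ = refl
∨-inr {false} p = p

not-true⇒false : ∀ {a} → not a ≡ true → a ≡ false
not-true⇒false {false} _ = refl

false⇒not-true : ∀ {a} → a ≡ false → not a ≡ true
false⇒not-true refl = refl

true-or-false : ∀ a → a ≡ true ⊎ a ≡ false
true-or-false true  = inj₁ refl
true-or-false false = inj₂ refl

true≢false : ∀ {a : Bool} → a ≡ true → a ≡ false → ⊥
true≢false refl ()

¬true⇒false : ∀ {a} → ¬ (a ≡ true) → a ≡ false
¬true⇒false {true}  p = ⊥-elim (p refl)
¬true⇒false {false} _ = refl

Bool-ext : ∀ {a b} → (a ≡ true → b ≡ true) → (b ≡ true → a ≡ true) → a ≡ b
Bool-ext {true}  {_}     p _ = sym (p refl)
Bool-ext {false} {true}  _ q = q refl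
Bool-ext {false} {false} _ _ = refl

≤ᵇ-true : ∀ {a b} → a ≤ b → (a ≤ᵇ b) ≡ true
≤ᵇ-true {a} {b} p with a ≤ᵇ b in eq
... | true  = refl
... | false = ⊥-elim (subst T eq (≤⇒≤ᵇ p))

true-≤ᵇ : ∀ {a b} → (a ≤ᵇ b) ≡ true → a ≤ b
true-≤ᵇ {a} {b} p = ≤ᵇ⇒≤ a b (subst T (sym p) tt)

<ᵇ-true : ∀ {a b} → a < b → (a <ᵇ b) ≡ true
<ᵇ-true {a} {b} p with a <ᵇ b in eq
... | true  = refl
... | false = ⊥-elim (subst T eq (<⇒<ᵇ p))

eqFin⇒≡ : ∀ {n} {u v : Fin n} → eqFin u v ≡ true → u ≡ v
eqFin⇒≡ {u = u} {v} p with u ≟ v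
... | yes q = q

≡⇒eqFin : ∀ {n} {u v : Fin n} → u ≡ v → eqFin u v ≡ true
≡⇒eqFin refl = eqFin-refl _

≢⇒eqFin : ∀ {n} {u v : Fin n} → u ≢ v → eqFin u v ≡ false
≢⇒eqFin ne = ¬true⇒false (ne ∘ eqFin⇒≡)

anyFin-elim : ∀ {n} (f : Fin n → Bool) → anyFin f ≡ true → Σ[ i ∈ Fin n ] f i ≡ true
anyFin-elim {suc n} f p with ∨-split p
... | inj₁ q = zero , q
... | inj₂ q = let i , r = anyFin-elim (f ∘ suc) q in suc i , r

anyFin-intro : ∀ {n} (f : Fin n → Bool) i → f i ≡ true → anyFin f ≡ true
anyFin-intro f zero    p = ∨-inl p
anyFin-intro f (suc i) p = ∨-inr {f zero} (anyFin-intro (f ∘ suc) i p)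

-- Sums and cardinalities

ind : Bool → ℕ
ind b = if b then 1 else 0

ind-mono : ∀ {a b} → (a ≡ true → b ≡ true) → ind a ≤ ind b
ind-mono {true}  p rewrite p refl = ≤-refl
ind-mono {false} _ = z≤n

sumFin-cong : ∀ {n} {f g : Fin n → ℕ} → (∀ i → f i ≡ g i) → sumFin f ≡ sumFin g
sumFin-cong {zero}  p = refl
sumFin-cong {suc n} p = cong₂ _+_ (p zero) (sumFin-cong (p ∘ suc))

sumFin-mono : ∀ {n} {f g : Fin n → ℕ} → (∀ i → f i ≤ g i) → sumFin f ≤ sumFin g
sumFin-mono {zero}  p = z≤n
sumFin-mono {suc n} p = +-mono-≤ (p zero) (sumFin-mono (p ∘ suc))

sumFin-mono-< : ∀ {n} {f g : Fin n → ℕ} → (∀ i → f i ≤ g i) → ∀ i → f i < g i → sumFin f < sumFin g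
sumFin-mono-< p zero    q = +-mono-<-≤ q (sumFin-mono (p ∘ suc))
sumFin-mono-< p (suc i) q = +-mono-≤-< (p zero) (sumFin-mono-< (p ∘ suc) i q)

+-interchange : ∀ a b c d → a + b + (c + d) ≡ a + c + (b + d)
+-interchange = solve-∀

sumFin-+ : ∀ {n} (f g : Fin n → ℕ) → sumFin (λ i → f i + g i) ≡ sumFin f + sumFin g
sumFin-+ {zero}  f g = refl
sumFin-+ {suc n} f g = trans (cong (f zero + g zero +_) (sumFin-+ (f ∘ suc) (g ∘ suc)))
  (+-interchange (f zero) (g zero) (sumFin (f ∘ suc)) (sumFin (g ∘ suc)))

sumFin-0 : ∀ n → sumFin {n} (λ _ → 0) ≡ 0
sumFin-0 zero    = refl
sumFin-0 (suc n) = sumFin-0 n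

sumFin-swap : ∀ {m n} (f : Fin m → Fin n → ℕ) →
  sumFin (λ i → sumFin (f i)) ≡ sumFin (λ j → sumFin (λ i → f i j))
sumFin-swap {zero}  {n} f = sym (sumFin-0 n)
sumFin-swap {suc m} {n} f = trans (cong (sumFin (f zero) +_) (sumFin-swap (f ∘ suc)))
  (sym (sumFin-+ (f zero) (λ j → sumFin (λ i → f (suc i) j))))

countFin-as-sum : ∀ {n} (U : Fin n → Bool) → countFin U ≡ sumFin (ind ∘ U)
countFin-as-sum {zero}  U = refl
countFin-as-sum {suc n} U = cong (ind (U zero) +_) (countFin-as-sum (U ∘ suc))

countFin-mono : ∀ {n} {U V : Fin n → Bool} → (∀ x → U x ≡ true → V x ≡ true) → countFin U ≤ countFin V
countFin-mono {zero}  p = z≤n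
countFin-mono {suc n} p = +-mono-≤ (ind-mono (p zero)) (countFin-mono (p ∘ suc))

countFin-mono-< : ∀ {n} {U V : Fin n → Bool} → (∀ x → U x ≡ true → V x ≡ true) →
  ∀ x → U x ≡ false → V x ≡ true → countFin U < countFin V
countFin-mono-< {U = U} {V} p zero    q r rewrite q | r = s≤s (countFin-mono (p ∘ suc))
countFin-mono-< p (suc x) q r = +-mono-≤-< (ind-mono (p zero)) (countFin-mono-< (p ∘ suc) x q r)

countFin-∨ : ∀ {n} (U V : Fin n → Bool) → countFin (λ x → U x ∨ V x) ≤ countFin U + countFin V
countFin-∨ {zero}  U V = z≤n
countFin-∨ {suc n} U V = ≤-trans (+-mono-≤ (ind-∨ (U zero) (V zero)) (countFin-∨ (U ∘ suc) (V ∘ suc)))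
  (≤-reflexive (+-interchange (ind (U zero)) (ind (V zero)) (countFin (U ∘ suc)) (countFin (V ∘ suc))))
  where
  ind-∨ : ∀ a b → ind (a ∨ b) ≤ ind a + ind b
  ind-∨ true  b = s≤s z≤n
  ind-∨ false b = ≤-refl

countFin-∅ : ∀ {n} {U : Fin n → Bool} → (∀ x → U x ≡ false) → countFin U ≡ 0
countFin-∅ {zero}  p = refl
countFin-∅ {suc n} p rewrite p zero = countFin-∅ (p ∘ suc)

countFin-pos : ∀ {n} {U : Fin n → Bool} x → U x ≡ true → 0 < countFin U
countFin-pos {U = U} zero    p rewrite p = s≤s z≤n
countFin-pos {U = U} (suc x) p = ≤-trans (countFin-pos x p) (m≤n+m _ (ind (U zero)))

-- `reindex` moves degree sums between a subset of the vertices of `G` and the abstract vertex set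
-- of a minor.
record Enumeration {n} (U : Fin n → Bool) (m : ℕ) : Set where
  field
    to      : Fin m → Fin n
    to-in   : ∀ i → U (to i) ≡ true
    to-inj  : ∀ i j → to i ≡ to j → i ≡ j
    to-onto : ∀ x → U x ≡ true → Σ[ i ∈ Fin m ] to i ≡ x
    reindex : ∀ (f : Fin n → ℕ) → sumFin (f ∘ to) ≡ sumFin (λ x → if U x then f x else 0)

enumerate : ∀ {n} (U : Fin n → Bool) → Enumeration U (countFin U)
enumerate {zero}  U = record
  { to = λ () ; to-in = λ () ; to-inj = λ () ; to-onto = λ () ; reindex = λ _ → refl }
enumerate {suc n} U with U zero in U0 | enumerate (U ∘ suc)
... | false | E = record
  { to      = suc ∘ to
  ; to-in   = to-in
  ; to-inj  = λ i j p → to-inj i j (Fin.suc-injective p)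
  ; to-onto = λ { zero p → ⊥-elim (true≢false p U0)
                ; (suc x) p → let i , q = to-onto x p in i , cong suc q }
  ; reindex = λ f → trans (reindex (f ∘ suc)) (cong (λ b → (if b then f zero else 0) + sumFin (λ x → if U (suc x) then f (suc x) else 0)) (sym U0))
  } where open Enumeration E
... | true  | E = record
  { to      = λ { zero → zero ; (suc i) → suc (to i) }
  ; to-in   = λ { zero → U0 ; (suc i) → to-in i }
  ; to-inj  = λ { zero zero _ → refl ; (suc i) (suc j) p → cong suc (to-inj i j (Fin.suc-injective p)) }
  ; to-onto = λ { zero _ → zero , refl
                ; (suc x) p → let i , q = to-onto x p in suc i , cong suc q }
  ; reindex = λ f → trans (cong (f zero +_) (reindex (f ∘ suc)))
                          (cong (λ b → (if b then f zero else 0) + sumFin (λ x → if U (suc x) then f (suc x) else 0)) (sym U0))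
  } where open Enumeration E

countFin-upper : ∀ {n q} (U : Fin n → Bool) (f : ∀ x → U x ≡ true → Fin q) →
  (∀ x y p p' → f x p ≡ f y p' → x ≡ y) → countFin U ≤ q
countFin-upper U f inj = Fin.injective⇒≤ {f = λ i → f (to i) (to-in i)}
  (λ {i} {j} p → to-inj i j (inj _ _ _ _ p))
  where open Enumeration (enumerate U)

countFin-singleton : ∀ {n} (x : Fin n) → countFin (eqFin x) ≤ 1
countFin-singleton x = countFin-upper (eqFin x) (λ _ _ → zero)
  (λ y z p p' _ → trans (sym (eqFin⇒≡ p)) (eqFin⇒≡ p'))

-- Separators and hubs must be indexed by a type of fixed size if colours and types are to be
-- counted, so surplus indices repeat `default`.
cover : ∀ {n d} (U : Fin n → Bool) → countFin U ≤ d → Fin n →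
  Σ[ e ∈ (Fin d → Fin n) ] (∀ x → U x ≡ true → Σ[ i ∈ Fin d ] e i ≡ x)
cover {n} {d} U le default = e , onto
  where
  open Enumeration (enumerate U)
  e : Fin d → Fin n
  e i with toℕ i <? countFin U
  ... | yes lt = to (fromℕ< lt)
  ... | no  _  = default
  e-inject : ∀ j → e (inject≤ j le) ≡ to j
  e-inject j with toℕ (inject≤ j le) <? countFin U
  ... | yes lt = cong to (Fin.toℕ-injective (trans (Fin.toℕ-fromℕ< lt) (Fin.toℕ-inject≤ j le)))
  ... | no  nl = ⊥-elim (nl (subst (_< countFin U) (sym (Fin.toℕ-inject≤ j le)) (Fin.toℕ<n j)))
  onto : ∀ x → U x ≡ true → Σ[ i ∈ Fin d ] e i ≡ x
  onto x p = let j , q = to-onto x p in inject≤ j le , trans (e-inject j) q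

sumFin-lower : ∀ {n} (U : Fin n → Bool) (f : Fin n → ℕ) c → (∀ x → U x ≡ true → c ≤ f x) →
  c * countFin U ≤ sumFin (λ x → if U x then f x else 0)
sumFin-lower {zero}  U f c h = ≤-reflexive (*-zeroʳ c)
sumFin-lower {suc n} U f c h = ≤-trans (≤-reflexive (*-distribˡ-+ c (ind (U zero)) _))
  (+-mono-≤ (head (U zero) (h zero)) (sumFin-lower (U ∘ suc) (f ∘ suc) c (h ∘ suc)))
  where
  head : ∀ b → (b ≡ true → c ≤ f zero) → c * ind b ≤ (if b then f zero else 0)
  head true  p = subst (_≤ f zero) (sym (*-identityʳ c)) (p refl)
  head false p = ≤-reflexive (*-zeroʳ c)

exists≤average : ∀ {n} (U : Fin n → Bool) (f : Fin n → ℕ) c → 0 < countFin U →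
  sumFin (λ x → if U x then f x else 0) ≤ c * countFin U → Σ[ x ∈ Fin n ] (U x ≡ true × f x ≤ c)
exists≤average U f c pos le with Fin.any? (λ x → (U x Bool.≟ true) ×-dec (f x ≤? c))
... | yes r = r
... | no ¬r = ⊥-elim (<-irrefl refl (<-≤-trans (m<n+m (c * countFin U) pos)
  (≤-trans (sumFin-lower U f (suc c) (λ x p → ≰⇒> (λ q → ¬r (x , p , q)))) le)))

-- If every colour were attained, a choice of preimages would map `Fin (suc w)` injectively into
-- `Fin w`.
fresh : ∀ {w} (f : Fin w → Fin (suc w)) → Σ[ c ∈ Fin (suc w) ] (∀ i → f i ≢ c)
fresh {w} f with Fin.any? (λ c → Fin.all? (λ i → ¬? (f i ≟ c)))
... | yes r = r
... | no ¬r = ⊥-elim (Fin.<⇒≢ (proj₁ (proj₂ (proj₂ hole)))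
  (trans (sym (proj₂ (preimage _))) (trans (cong f (proj₂ (proj₂ (proj₂ hole)))) (proj₂ (preimage _)))))
  where
  preimage : ∀ c → Σ[ i ∈ Fin w ] f i ≡ c
  preimage c with Fin.any? (λ i → f i ≟ c)
  ... | yes p = p
  ... | no ¬p = ⊥-elim (¬r (c , λ i q → ¬p (i , q)))
  hole = Fin.pigeonhole ≤-refl (proj₁ ∘ preimage)

-- `edgeCount` sees each edge only from its smaller end; transposing the double sum shows that the
-- larger ends contribute the same amount.
degreeSum≤ : (H : Graph) → sumFin (λ i → countFin (adj H i)) ≤ 2 * edgeCount H
degreeSum≤ H = begin
  sumFin (λ i → countFin (adj H i))
    ≤⟨ sumFin-mono (λ i → ≤-trans (countFin-mono (split i)) (countFin-∨ (up i) (down i))) ⟩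
  sumFin (λ i → countFin (up i) + countFin (down i))
    ≡⟨ sumFin-+ (countFin ∘ up) (countFin ∘ down) ⟩
  edgeCount H + sumFin (countFin ∘ down)
    ≡⟨ cong (edgeCount H +_) down≡up ⟩
  edgeCount H + edgeCount H
    ≡⟨ cong (edgeCount H +_) (sym (+-identityʳ _)) ⟩
  2 * edgeCount H ∎
  where
  open ≤-Reasoning
  up down : Fin (size H) → Fin (size H) → Bool
  up   i j = adj H i j ∧ (toℕ i <ᵇ toℕ j)
  down i j = adj H i j ∧ (toℕ j <ᵇ toℕ i)
  split : ∀ i j → adj H i j ≡ true → up i j ∨ down i j ≡ true
  split i j p with <-cmp (toℕ i) (toℕ j)
  ... | tri< lt _ _ = ∨-inl (∧-join p (<ᵇ-true lt))
  ... | tri> _ _ gt = ∨-inr {up i j} (∧-join p (<ᵇ-true gt))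
  ... | tri≈ _ eq _ = ⊥-elim (true≢false p (trans (cong (adj H i) (sym (Fin.toℕ-injective eq))) (irrefl H i)))
  down≡up : sumFin (countFin ∘ down) ≡ edgeCount H
  down≡up = begin-equality
    sumFin (countFin ∘ down)                      ≡⟨ sumFin-cong (λ i → countFin-as-sum (down i)) ⟩
    sumFin (λ i → sumFin (λ j → ind (down i j))) ≡⟨ sumFin-swap (λ i j → ind (down i j)) ⟩
    sumFin (λ j → sumFin (λ i → ind (down i j)))
      ≡⟨ sumFin-cong (λ j → sumFin-cong (λ i → cong (λ b → ind (b ∧ (toℕ j <ᵇ toℕ i))) (adjSym H i j))) ⟩
    sumFin (λ j → sumFin (λ i → ind (up j i)))   ≡⟨ sym (sumFin-cong (λ j → countFin-as-sum (up j))) ⟩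
    edgeCount H ∎

-- Walks

Rel : ℕ → Set
Rel n = Fin n → Fin n → Bool

-- The vertices of the walk other than the first one satisfy P.
data Walk {n} (A : Rel n) (P : Fin n → Set) (u : Fin n) : ℕ → Fin n → Set where
  here : Walk A P u 0 u
  step : ∀ {j x y} → Walk A P u j x → A x y ≡ true → P y → Walk A P u (suc j) y

Anywhere : ∀ {n} → Fin n → Set
Anywhere _ = ⊤

module _ {n} {A : Rel n} where

  walk-end : ∀ {P u j v} → P u → Walk A P u j v → P v
  walk-end p here         = p
  walk-end _ (step _ _ p) = p

  walk-map : ∀ {P Q u j v} → (∀ x → P x → Q x) → Walk A P u j v → Walk A Q u j v
  walk-map f here         = here
  walk-map f (step w a p) = step (walk-map f w) a (f _ p)

  walk-++ : ∀ {P u i v j x} → Walk A P u i v → Walk A P v j x → Walk A P u (i + j) x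
  walk-++ {P} {u} {i} {v} w here = subst (λ k → Walk A P u k v) (sym (+-identityʳ i)) w
  walk-++ {P} {u} {i} {x = x} w (step w' a p) = subst (λ k → Walk A P u k x) (sym (+-suc i _)) (step (walk-++ w w') a p)

  walk-cons : ∀ {P u x j v} → A u x ≡ true → P x → Walk A P x j v → Walk A P u (suc j) v
  walk-cons a p here           = step here a p
  walk-cons a p (step w a' p') = step (walk-cons a p w) a' p'

  walk-uncons : ∀ {P u j v} → Walk A P u (suc j) v → Σ[ x ∈ Fin n ] (A u x ≡ true × P x × Walk A P x j v)
  walk-uncons (step here a p) = _ , a , p , here
  walk-uncons (step w@(step _ _ _) a p) = let x , a' , p' , w' = walk-uncons w in x , a' , p' , step w' a p

  walk-reverse : ∀ {P u j v} → (∀ x y → A x y ≡ A y x) → P u → Walk A P u j v → Walk A P v j u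
  walk-reverse A-sym p here         = here
  walk-reverse A-sym p (step w a _) =
    walk-cons (trans (A-sym _ _) a) (walk-end p w) (walk-reverse A-sym p w)

  reach-refl : ∀ k u → reach A k u u ≡ true
  reach-refl zero    u = eqFin-refl u
  reach-refl (suc k) u = ∨-inl (reach-refl k u)

  reach⇒walk : ∀ k {u v} → reach A k u v ≡ true → Σ[ j ∈ ℕ ] (j ≤ k × Walk A Anywhere u j v)
  reach⇒walk zero p rewrite eqFin⇒≡ p = 0 , z≤n , here
  reach⇒walk (suc k) p with ∨-split p
  ... | inj₁ q = let j , le , w = reach⇒walk k q in j , m≤n⇒m≤1+n le , w
  ... | inj₂ q = let x , r = anyFin-elim (λ x → A _ x ∧ reach A k x _) q
                     a , s = ∧-split r
                     j , le , w = reach⇒walk k s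
                 in suc j , s≤s le , walk-cons a tt w

  walk⇒reach : ∀ {k j P u v} → j ≤ k → Walk A P u j v → reach A k u v ≡ true
  walk⇒reach {k} {zero} _ here = reach-refl k _
  walk⇒reach {suc k} {suc j} {u = u} {v} (s≤s le) w =
    let x , a , _ , w' = walk-uncons w
    in ∨-inr {reach A k u v} (anyFin-intro (λ y → A u y ∧ reach A k y v) x (∧-join a (walk⇒reach le w')))

  -- The decidable form of `Walk`: like `step` it grows at the far end and leaves the centre free of
  -- `P`, whereas `reach` grows at the near end.
  ball : (Fin n → Bool) → ℕ → Fin n → Fin n → Bool
  ball P zero    u x = eqFin u x
  ball P (suc k) u x = ball P k u x ∨ (P x ∧ anyFin (λ y → ball P k u y ∧ A y x))

  ball-center : ∀ P k u → ball P k u u ≡ true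
  ball-center P zero    u = eqFin-refl u
  ball-center P (suc k) u = ∨-inl (ball-center P k u)

  ball⇒walk : ∀ P k {u x} → ball P k u x ≡ true →
    Σ[ j ∈ ℕ ] (j ≤ k × Walk A (λ y → P y ≡ true) u j x)
  ball⇒walk P zero p rewrite eqFin⇒≡ p = 0 , z≤n , here
  ball⇒walk P (suc k) p with ∨-split p
  ... | inj₁ q = let j , le , w = ball⇒walk P k q in j , m≤n⇒m≤1+n le , w
  ... | inj₂ q = let Px , r = ∧-split q
                     y , s = anyFin-elim (λ y → ball P k _ y ∧ A y _) r
                     b , a = ∧-split s
                     j , le , w = ball⇒walk P k b
                 in suc j , s≤s le , step w a Px

  walk⇒ball : ∀ {P k j u x} → j ≤ k → Walk A (λ y → P y ≡ true) u j x → ball P k u x ≡ true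
  walk⇒ball {P} {k} le here = ball-center P k _
  walk⇒ball {P} {suc k} {u = u} {x} (s≤s le) (step w a p) =
    ∨-inr {ball P k u x} (∧-join p (anyFin-intro (λ y → ball P k u y ∧ A y x) _ (∧-join (walk⇒ball le w) a)))

  visited : ∀ {P u j v} → Walk A P u j v → Fin n → Bool
  visited here                 _ = false
  visited (step {y = y} w _ _) x = visited w x ∨ eqFin y x

  visited-P : ∀ {P u j v} (w : Walk A P u j v) {x} → visited w x ≡ true → P x
  visited-P {P} (step w _ p) {x} q with ∨-split q
  ... | inj₁ r = visited-P w r
  ... | inj₂ r = subst P (eqFin⇒≡ r) p

  countFin-visited : ∀ {P u j v} (w : Walk A P u j v) → countFin (visited w) ≤ j
  countFin-visited here = ≤-reflexive (countFin-∅ {U = λ (_ : Fin n) → false} (λ _ → refl))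
  countFin-visited {j = suc j} (step {y = y} w _ _) = begin
    countFin (λ x → visited w x ∨ eqFin y x)   ≤⟨ countFin-∨ (visited w) (eqFin y) ⟩
    countFin (visited w) + countFin (eqFin y)  ≤⟨ +-mono-≤ (countFin-visited w) (countFin-singleton y) ⟩
    j + 1                                      ≡⟨ +-comm j 1 ⟩
    suc j ∎
    where open ≤-Reasoning

  walk-in-visited : ∀ {P u j v} (w : Walk A P u j v) → Walk A (λ x → visited w x ≡ true) u j v
  walk-in-visited here = here
  walk-in-visited (step {y = y} w a p) =
    step (walk-map (λ _ → ∨-inl) (walk-in-visited w)) a (∨-inr {visited w y} (eqFin-refl y))

  walk-to-visited : ∀ {P u j v} (w : Walk A P u j v) {x} → visited w x ≡ true →
    Σ[ i ∈ ℕ ] (i ≤ j × Walk A (λ y → visited w y ≡ true) u i x)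
  walk-to-visited w'@(step w _ _) q with ∨-split q
  ... | inj₁ r = let i , le , v = walk-to-visited w r in i , m≤n⇒m≤1+n le , walk-map (λ _ → ∨-inl) v
  ... | inj₂ r rewrite sym (eqFin⇒≡ r) = _ , ≤-refl , walk-in-visited w'

  -- Cutting at a vertex of least `L` turns an arbitrary walk into two walks that witness weak
  -- reachability of `min` from either end, with the total length kept.
  record MinSplit (P : Fin n → Set) (L : Fin n → ℕ) (u : Fin n) (j : ℕ) (v : Fin n) : Set where
    field
      min       : Fin n
      i₁ i₂     : ℕ
      lengths   : i₁ + i₂ ≡ j
      min≤start : L min ≤ L u
      min-P     : P min
      to-min    : Walk A (λ x → P x × L min ≤ L x) u i₁ min
      from-min  : Walk A (λ x → P x × L min ≤ L x) min i₂ v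

  min-split : ∀ {P u j v} L → P u → Walk A P u j v → MinSplit P L u j v
  min-split L p here = record
    { min = _ ; i₁ = 0 ; i₂ = 0 ; lengths = refl ; min≤start = ≤-refl ; min-P = p ; to-min = here ; from-min = here }
  min-split {P} {u} L p (step {y = y} w a q) with min-split L p w
  ... | s with ≤-total (L (MinSplit.min s)) (L y)
  ...   | inj₁ le = record
    { min = min ; i₁ = i₁ ; i₂ = suc i₂ ; lengths = trans (+-suc i₁ i₂) (cong suc lengths)
    ; min≤start = min≤start ; min-P = min-P ; to-min = to-min ; from-min = step from-min a (q , le) }
    where open MinSplit s
  ...   | inj₂ ge = record
    { min = y ; i₁ = suc (i₁ + i₂) ; i₂ = 0 ; lengths = trans (+-identityʳ _) (cong suc lengths)
    ; min≤start = ≤-trans ge min≤start ; min-P = q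
    ; to-min = step (walk-map (λ { _ (Px , le) → Px , ≤-trans ge le }) (walk-++ to-min from-min)) a (q , ≤-refl)
    ; from-min = here }
    where open MinSplit s

  -- Indices past the end repeat the last vertex, so positions are plain numbers and no bound has to
  -- be carried around.
  vertexAt : ∀ {P u j v} → Walk A P u j v → ℕ → Fin n
  vertexAt {u = u} here _ = u
  vertexAt (step {j} {y = y} w _ _) i with i ≤? j
  ... | yes _ = vertexAt w i
  ... | no  _ = y

  vertexAt-end : ∀ {P u j v} (w : Walk A P u j v) → vertexAt w j ≡ v
  vertexAt-end here = refl
  vertexAt-end (step {j} w _ _) with suc j ≤? j
  ... | yes q = ⊥-elim (1+n≰n q)
  ... | no  _ = refl

  vertexAt-step : ∀ {P u j x y} (w : Walk A P u j x) (a : A x y ≡ true) (p : P y) {i} → i ≤ j →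
    vertexAt (step {P = P} w a p) i ≡ vertexAt w i
  vertexAt-step {j = j} w a p {i} le with i ≤? j
  ... | yes _ = refl
  ... | no  q = ⊥-elim (q le)

  vertexAt-start : ∀ {P u j v} (w : Walk A P u j v) → vertexAt w 0 ≡ u
  vertexAt-start here         = refl
  vertexAt-start {P = P} (step w a p) = trans (vertexAt-step {P = P} w a p z≤n) (vertexAt-start w)

  vertexAt-adj : ∀ {P u j v} (w : Walk A P u j v) {i} → i < j →
    A (vertexAt w i) (vertexAt w (suc i)) ≡ true × P (vertexAt w (suc i))
  vertexAt-adj {P} w'@(step {j} w a p) {i} (s≤s le) with m≤n⇒m<n∨m≡n le
  ... | inj₁ lt = subst₂ (λ x y → A x y ≡ true × P y)
                    (sym (vertexAt-step {P = P} w a p le)) (sym (vertexAt-step {P = P} w a p lt)) (vertexAt-adj w lt)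
  ... | inj₂ refl = subst₂ (λ x y → A x y ≡ true × P y)
                      (sym (trans (vertexAt-step {P = P} w a p le) (vertexAt-end w))) (sym (vertexAt-end w')) (a , p)

  segment : ∀ {P} (f : ℕ → Fin n) a len →
    (∀ i → a ≤ i → i < len + a → A (f i) (f (suc i)) ≡ true × P (f (suc i))) →
    Walk A P (f a) len (f (len + a))
  segment f a zero      h = here
  segment f a (suc len) h =
    let e , p = h (len + a) (m≤n+m a len) ≤-refl
    in step (segment f a len (λ i le lt → h i le (m≤n⇒m≤1+n lt))) e p

walk-restrict : ∀ (G : Graph) (B : Fin (size G) → Bool) {u j v} → B u ≡ true →
  Walk (adj G) (λ x → B x ≡ true) u j v → Walk (restrict G B) Anywhere u j v
walk-restrict G B p here         = here
walk-restrict G B p (step w a q) =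
  step (walk-restrict G B p w) (∧-join (walk-end {P = λ x → B x ≡ true} p w) (∧-join q a)) tt

-- Shallow minors

-- A minor model whose branch sets are indexed by a set U of vertices of G.
record MinorModel (G : Graph) (t : ℕ) (U : Fin (size G) → Bool)
                  (E branch : Fin (size G) → Fin (size G) → Bool) : Set where
  field
    E-sym    : ∀ u v → E u v ≡ E v u
    E-irrefl : ∀ u → E u u ≡ false
    disjoint : ∀ u v x → U u ≡ true → U v ≡ true → branch u x ≡ true → branch v x ≡ true → u ≡ v
    self     : ∀ u → U u ≡ true → branch u u ≡ true
    radius   : ∀ u x → U u ≡ true → branch u x ≡ true →
      Σ[ j ∈ ℕ ] (j ≤ t × Walk (adj G) (λ y → branch u y ≡ true) u j x)
    edges    : ∀ u v → U u ≡ true → U v ≡ true → E u v ≡ true →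
      Σ[ x ∈ Fin (size G) ] Σ[ y ∈ Fin (size G) ] (branch u x ≡ true × branch v y ≡ true × adj G x y ≡ true)

DensityBound : Graph → ℕ → ℕ → Set
DensityBound G t c = ∀ H → DepthMinor t H G → edgeCount H ≤ c * size H

degreeSumWithin : ∀ {n} → (Fin n → Bool) → (Fin n → Fin n → Bool) → ℕ
degreeSumWithin U E = sumFin (λ x → if U x then countFin (λ y → U y ∧ E x y) else 0)

-- Enumerating `U` makes the model a genuine minor `H`; the factor 2 turns its edge count into a
-- degree sum.
minorModel-density : ∀ c {G t U E branch} → DensityBound G t c → MinorModel G t U E branch →
  degreeSumWithin U E ≤ 2 * c * countFin U
minorModel-density c {G} {t} {U} {E} {branch} bound M = begin
  degreeSumWithin U E                                    ≡⟨ sym (reindex (λ x → countFin (λ y → U y ∧ E x y))) ⟩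
  sumFin (λ i → countFin (λ y → U y ∧ E (to i) y))     ≤⟨ sumFin-mono pull ⟩
  sumFin (λ i → countFin (adj H i))                     ≤⟨ degreeSum≤ H ⟩
  2 * edgeCount H                                        ≤⟨ *-monoʳ-≤ 2 (bound H minor) ⟩
  2 * (c * countFin U)                                   ≡⟨ sym (*-assoc 2 c (countFin U)) ⟩
  2 * c * countFin U ∎
  where
  open ≤-Reasoning
  open MinorModel M
  open Enumeration (enumerate U)
  H : Graph
  H = record { size = countFin U ; adj = λ i j → E (to i) (to j)
             ; adjSym = λ i j → E-sym (to i) (to j) ; irrefl = λ i → E-irrefl (to i) }
  minor : DepthMinor t H G
  minor = record
    { branch   = branch ∘ to
    ; disjoint = λ i j x p q → to-inj i j (disjoint _ _ x (to-in i) (to-in j) p q)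
    ; radius   = λ i → to i , self _ (to-in i) , λ x p →
        let j , le , w = radius _ x (to-in i) p
        in walk⇒reach le (walk-restrict G (branch (to i)) (self _ (to-in i)) w)
    ; edges    = λ i j → edges _ _ (to-in i) (to-in j) }
  pull : ∀ i → countFin (λ y → U y ∧ E (to i) y) ≤ countFin (adj H i)
  pull i = countFin-upper _ (λ y p → proj₁ (index y p))
    (λ y z p q r → trans (sym (proj₂ (index y p))) (trans (cong (to ∘ N.to) r) (proj₂ (index z q))))
    where
    module N = Enumeration (enumerate (adj H i))
    index : ∀ y → U y ∧ E (to i) y ≡ true → Σ[ k ∈ Fin _ ] to (N.to k) ≡ y
    index y p = let Uy , Ey = ∧-split p
                    j , to-j = to-onto y Uy
                    k , to-k = N.to-onto j (trans (cong (E (to i)) to-j) Ey)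
                in k , trans (cong to to-k) to-j

-- Discarding branch sets leaves a minor, so sparsity holds on every subset, as the greedy choice of
-- an independent set demands.
minorModel-⊆ : ∀ {G t U V E branch} → (∀ x → V x ≡ true → U x ≡ true) →
  MinorModel G t U E branch → MinorModel G t V E branch
minorModel-⊆ V⊆U M = record
  { E-sym = E-sym ; E-irrefl = E-irrefl
  ; disjoint = λ u v x p q → disjoint u v x (V⊆U u p) (V⊆U v q)
  ; self = λ u p → self u (V⊆U u p)
  ; radius = λ u x p → radius u x (V⊆U u p)
  ; edges = λ u v p q → edges u v (V⊆U u p) (V⊆U v q) }
  where open MinorModel M

-- Greedy independent sets in sparse relations

Independent : ∀ {n} → Rel n → (Fin n → Bool) → Set
Independent E R = ∀ u v → R u ≡ true → R v ≡ true → E u v ≡ false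

-- Greedy choice: sparsity of the remaining set supplies a vertex with at most `c` neighbours in it,
-- and taking this vertex deletes at most `suc c` vertices.
independent-set : ∀ {n} (E : Rel n) c → (∀ u v → E u v ≡ E v u) → (∀ u → E u u ≡ false) → ∀ U →
  (∀ V → (∀ x → V x ≡ true → U x ≡ true) → degreeSumWithin V E ≤ c * countFin V) →
  Σ[ R ∈ (Fin n → Bool) ] ((∀ x → R x ≡ true → U x ≡ true) × Independent E R × countFin U ≤ suc c * countFin R)
independent-set {n} E c E-sym E-irrefl U₀ sparse = go (countFin U₀) U₀ ≤-refl (λ _ p → p)
  where
  go : ∀ f U → countFin U ≤ f → (∀ x → U x ≡ true → U₀ x ≡ true) →
    Σ[ R ∈ (Fin n → Bool) ] ((∀ x → R x ≡ true → U x ≡ true) × Independent E R × countFin U ≤ suc c * countFin R)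
  go f U le U⊆ with countFin U ≤? 0
  ... | yes empty = U , (λ _ p → p) , (λ u v p _ → ⊥-elim (n≮0 (<-≤-trans (countFin-pos u p) empty))) , ≤-trans empty z≤n
  go zero U le U⊆ | no nonempty = ⊥-elim (nonempty le)
  go (suc f) U le U⊆ | no nonempty
    with exists≤average U (λ x → countFin (λ y → U y ∧ E x y)) c (≰⇒> nonempty) (sparse U U⊆)
  ... | v , Uv , deg≤c = R , R⊆U , R-indep , bound
    where
    near U' : Fin n → Bool
    near x = eqFin v x ∨ (U x ∧ E v x)
    U' x = U x ∧ not (near x)
    U'⊆U : ∀ x → U' x ≡ true → U x ≡ true
    U'⊆U x = proj₁ ∘ ∧-split
    U'v : U' v ≡ false
    U'v = ¬true⇒false (λ p → true≢false {near v} (∨-inl (eqFin-refl v)) (not-true⇒false (proj₂ (∧-split p))))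
    rest = go f U' (≤-pred (≤-trans (countFin-mono-< U'⊆U v U'v Uv) le)) (λ x → U⊆ x ∘ U'⊆U x)
    R' = proj₁ rest
    R'⊆U' = proj₁ (proj₂ rest)
    R : Fin n → Bool
    R x = eqFin v x ∨ R' x
    R⊆U : ∀ x → R x ≡ true → U x ≡ true
    R⊆U x p with ∨-split p
    ... | inj₁ q = subst (λ y → U y ≡ true) (eqFin⇒≡ q) Uv
    ... | inj₂ q = U'⊆U x (R'⊆U' x q)
    v-R' : ∀ x → R' x ≡ true → E v x ≡ false
    v-R' x q = ¬true⇒false (λ e → true≢false {near x} (∨-inr {eqFin v x} (∧-join (U'⊆U x (R'⊆U' x q)) e))
                 (not-true⇒false (proj₂ (∧-split {U x} (R'⊆U' x q)))))
    R-indep : Independent E R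
    R-indep x y p q with ∨-split p | ∨-split q
    ... | inj₁ p' | inj₁ q' = subst₂ (λ a b → E a b ≡ false) (eqFin⇒≡ p') (eqFin⇒≡ q') (E-irrefl v)
    ... | inj₁ p' | inj₂ q' = subst (λ a → E a y ≡ false) (eqFin⇒≡ p') (v-R' y q')
    ... | inj₂ p' | inj₁ q' = trans (E-sym x y) (subst (λ a → E a x ≡ false) (eqFin⇒≡ q') (v-R' x p'))
    ... | inj₂ p' | inj₂ q' = proj₁ (proj₂ (proj₂ rest)) x y p' q'
    U-split : ∀ x → U x ≡ true → U' x ∨ near x ≡ true
    U-split x p with true-or-false (near x)
    ... | inj₁ q = ∨-inr {U' x} q
    ... | inj₂ q = ∨-inl (∧-join p (false⇒not-true q))
    R'<R : countFin R' < countFin R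
    R'<R = countFin-mono-< (λ x → ∨-inr {eqFin v x}) v
      (¬true⇒false (λ q → true≢false (R'⊆U' v q) U'v)) (∨-inl (eqFin-refl v))
    open ≤-Reasoning
    bound : countFin U ≤ suc c * countFin R
    bound = begin
      countFin U                                 ≤⟨ countFin-mono U-split ⟩
      countFin (λ x → U' x ∨ near x)             ≤⟨ countFin-∨ U' near ⟩
      countFin U' + countFin near                ≤⟨ +-monoʳ-≤ (countFin U') (≤-trans
        (countFin-∨ (eqFin v) (λ x → U x ∧ E v x)) (+-mono-≤ (countFin-singleton v) deg≤c)) ⟩
      countFin U' + suc c                        ≤⟨ +-monoˡ-≤ (suc c) (proj₂ (proj₂ (proj₂ rest))) ⟩
      suc c * countFin R' + suc c                ≡⟨ trans (+-comm _ (suc c)) (sym (*-suc (suc c) (countFin R'))) ⟩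
      suc c * suc (countFin R')                  ≤⟨ *-monoʳ-≤ (suc c) R'<R ⟩
      suc c * countFin R ∎

-- Disjoint walks of length at most t + 1 between vertices of S, with interiors M outside S;
-- contracting them onto their end vertices gives the minor E.
record Packing (G : Graph) (S : Fin (size G) → Bool) (t : ℕ) : Set where
  field
    E branch : Rel (size G)
    M        : Fin (size G) → Bool
    model    : MinorModel G t S E branch
    branch⊆  : ∀ u x → S u ≡ true → branch u x ≡ true → x ≡ u ⊎ M x ≡ true
    M∩S      : ∀ x → M x ≡ true → S x ≡ false
    M-size   : countFin M ≤ t * degreeSumWithin S E

  unused : Fin (size G) → Bool
  unused x = not (S x ∨ M x)

  unused⇒¬S : ∀ {x} → unused x ≡ true → S x ≡ true → ⊥
  unused⇒¬S p q = true≢false (∨-inl q) (not-true⇒false p)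

  unused⇒¬M : ∀ {x} → unused x ≡ true → M x ≡ true → ⊥
  unused⇒¬M {x} p q = true≢false (∨-inr {S x} q) (not-true⇒false p)

Maximal : ∀ {G S t} → Packing G S t → Set
Maximal {G} {S} {t} K = ∀ {u v y j} → S u ≡ true → S v ≡ true → u ≢ v → Packing.E K u v ≡ false →
  j ≤ t → Walk (adj G) (λ x → Packing.unused K x ≡ true) u j y → adj G y v ≡ true → ⊥

emptyPacking : ∀ G S t → Packing G S t
emptyPacking G S t = record
  { E = λ _ _ → false ; branch = eqFin ; M = λ _ → false
  ; model = record
    { E-sym = λ _ _ → refl ; E-irrefl = λ _ → refl
    ; disjoint = λ u v x _ _ p q → trans (eqFin⇒≡ p) (sym (eqFin⇒≡ q))
    ; self = λ u _ → eqFin-refl u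
    ; radius = λ u x _ p → 0 , z≤n , subst (Walk (adj G) _ u 0) (eqFin⇒≡ p) here
    ; edges = λ _ _ _ _ () }
  ; branch⊆ = λ u x _ p → inj₁ (sym (eqFin⇒≡ p))
  ; M∩S = λ _ ()
  ; M-size = ≤-trans (≤-reflexive (countFin-∅ {U = λ (_ : Fin (size G)) → false} (λ _ → refl))) z≤n }

module _ {G : Graph} {S : Fin (size G) → Bool} {t : ℕ} (K : Packing G S t) where
  open Packing K
  open MinorModel model

  -- The whole interior of the new path goes to the branch set of `u`. The walk starts there and has
  -- at most `t` steps, so the radius stays within `t`, and the last edge realises the adjacency
  -- with `v`.
  extend : ∀ {u v y j} → S u ≡ true → S v ≡ true → u ≢ v → E u v ≡ false →
    j ≤ t → Walk (adj G) (λ x → unused x ≡ true) u j y → adj G y v ≡ true →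
    Σ[ K' ∈ Packing G S t ] degreeSumWithin S E < degreeSumWithin S (Packing.E K')
  extend {u} {v} {y} {j} Su Sv u≢v ¬Euv j≤t w yv = record
    { E = E' ; branch = branch' ; M = M'
    ; model = record
      { E-sym = λ a b → Bool-ext (E'-sym a b) (E'-sym b a)
      ; E-irrefl = λ a → ¬true⇒false (E'-irrefl a)
      ; disjoint = disjoint'
      ; self = λ a Sa → ∨-inl (self a Sa)
      ; radius = radius'
      ; edges = edges' }
    ; branch⊆ = branch'⊆
    ; M∩S = λ x p → [ M∩S x , (λ q → ¬true⇒false (unused⇒¬S (visited-P w q))) ]′ (∨-split p)
    ; M-size = M'-size } , E<E'
    where
    pair E' branch' : Rel (size G)
    pair a b = (eqFin u a ∧ eqFin v b) ∨ (eqFin v a ∧ eqFin u b)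
    E' a b = E a b ∨ pair a b
    branch' a x = branch a x ∨ (eqFin u a ∧ visited w x)
    M' : Fin (size G) → Bool
    M' x = M x ∨ visited w x
    pair-elim : ∀ a b → pair a b ≡ true → (u ≡ a × v ≡ b) ⊎ (v ≡ a × u ≡ b)
    pair-elim a b p with ∨-split p
    ... | inj₁ q = inj₁ (eqFin⇒≡ (proj₁ (∧-split q)) , eqFin⇒≡ (proj₂ (∧-split {eqFin u a} q)))
    ... | inj₂ q = inj₂ (eqFin⇒≡ (proj₁ (∧-split q)) , eqFin⇒≡ (proj₂ (∧-split {eqFin v a} q)))
    E'-sym : ∀ a b → E' a b ≡ true → E' b a ≡ true
    E'-sym a b p with ∨-split p
    ... | inj₁ q = ∨-inl (trans (E-sym b a) q)
    ... | inj₂ q with pair-elim a b q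
    ...   | inj₁ (refl , refl) = ∨-inr {E b a} (∨-inr {eqFin u v ∧ eqFin v u} (∧-join (eqFin-refl v) (eqFin-refl u)))
    ...   | inj₂ (refl , refl) = ∨-inr {E b a} (∨-inl (∧-join (eqFin-refl u) (eqFin-refl v)))
    E'-irrefl : ∀ a → ¬ (E' a a ≡ true)
    E'-irrefl a p with ∨-split p
    ... | inj₁ q = true≢false q (E-irrefl a)
    ... | inj₂ q with pair-elim a a q
    ...   | inj₁ (p₁ , p₂) = u≢v (trans p₁ (sym p₂))
    ...   | inj₂ (p₁ , p₂) = u≢v (trans p₂ (sym p₁))
    old≢new : ∀ a x → S a ≡ true → branch a x ≡ true → visited w x ≡ true → ⊥
    old≢new a x Sa p q with branch⊆ a x Sa p
    ... | inj₁ refl = unused⇒¬S (visited-P w q) Sa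
    ... | inj₂ Mx   = unused⇒¬M (visited-P w q) Mx
    disjoint' : ∀ a b x → S a ≡ true → S b ≡ true → branch' a x ≡ true → branch' b x ≡ true → a ≡ b
    disjoint' a b x Sa Sb p q with ∨-split p | ∨-split q
    ... | inj₁ p' | inj₁ q' = disjoint a b x Sa Sb p' q'
    ... | inj₁ p' | inj₂ q' = ⊥-elim (old≢new a x Sa p' (proj₂ (∧-split {eqFin u b} q')))
    ... | inj₂ p' | inj₁ q' = ⊥-elim (old≢new b x Sb q' (proj₂ (∧-split {eqFin u a} p')))
    ... | inj₂ p' | inj₂ q' = trans (sym (eqFin⇒≡ (proj₁ (∧-split {eqFin u a} p')))) (eqFin⇒≡ (proj₁ (∧-split {eqFin u b} q')))
    visited⇒branch' : ∀ x → visited w x ≡ true → branch' u x ≡ true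
    visited⇒branch' x q = ∨-inr {branch u x} (∧-join (eqFin-refl u) q)
    radius' : ∀ a x → S a ≡ true → branch' a x ≡ true →
      Σ[ i ∈ ℕ ] (i ≤ t × Walk (adj G) (λ z → branch' a z ≡ true) a i x)
    radius' a x Sa p with ∨-split p
    ... | inj₁ q = let i , le , w' = radius a x Sa q in i , le , walk-map (λ _ → ∨-inl) w'
    ... | inj₂ q with ∧-split {eqFin u a} q
    ...   | ua , r rewrite sym (eqFin⇒≡ ua) =
      let i , le , w' = walk-to-visited w r in i , ≤-trans le j≤t , walk-map visited⇒branch' w'
    y∈branch' : branch' u y ≡ true
    y∈branch' = walk-end {P = λ z → branch' u z ≡ true} (∨-inl (self u Su)) (walk-map visited⇒branch' (walk-in-visited w))
    edges' : ∀ a b → S a ≡ true → S b ≡ true → E' a b ≡ true →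
      Σ[ x ∈ _ ] Σ[ z ∈ _ ] (branch' a x ≡ true × branch' b z ≡ true × adj G x z ≡ true)
    edges' a b Sa Sb p with ∨-split p
    ... | inj₁ q = let x , z , bx , bz , e = edges a b Sa Sb q in x , z , ∨-inl bx , ∨-inl bz , e
    ... | inj₂ q with pair-elim a b q
    ...   | inj₁ (refl , refl) = y , v , y∈branch' , ∨-inl (self v Sv) , yv
    ...   | inj₂ (refl , refl) = v , y , ∨-inl (self v Sv) , y∈branch' , trans (adjSym G v y) yv
    branch'⊆ : ∀ a x → S a ≡ true → branch' a x ≡ true → x ≡ a ⊎ M' x ≡ true
    branch'⊆ a x Sa p with ∨-split p
    ... | inj₁ q = [ inj₁ , inj₂ ∘ ∨-inl ]′ (branch⊆ a x Sa q)
    ... | inj₂ q = inj₂ (∨-inr {M x} (proj₂ (∧-split {eqFin u a} q)))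
    degree≤ : ∀ x → (if S x then countFin (λ z → S z ∧ E x z) else 0) ≤ (if S x then countFin (λ z → S z ∧ E' x z) else 0)
    degree≤ x with S x
    ... | true  = countFin-mono (λ z p → ∧-join (proj₁ (∧-split p)) (∨-inl (proj₂ (∧-split {S z} p))))
    ... | false = z≤n
    E<E' : degreeSumWithin S E < degreeSumWithin S E'
    E<E' = sumFin-mono-< degree≤ u strict
      where
      strict : (if S u then countFin (λ z → S z ∧ E u z) else 0) < (if S u then countFin (λ z → S z ∧ E' u z) else 0)
      strict rewrite Su = countFin-mono-< (λ z p → ∧-join (proj₁ (∧-split p)) (∨-inl (proj₂ (∧-split {S z} p)))) v
        (¬true⇒false (λ p → true≢false (proj₂ (∧-split {S v} p)) ¬Euv))
        (∧-join Sv (∨-inr {E u v} (∨-inl (∧-join (eqFin-refl u) (eqFin-refl v)))))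
    -- The path uses at most `t` fresh vertices, which are paid for by the increase of the degree
    -- sum.
    M'-size : countFin M' ≤ t * degreeSumWithin S E'
    M'-size = begin
      countFin M'                         ≤⟨ countFin-∨ M (visited w) ⟩
      countFin M + countFin (visited w)   ≤⟨ +-mono-≤ M-size (≤-trans (countFin-visited w) j≤t) ⟩
      t * degreeSumWithin S E + t         ≡⟨ trans (+-comm _ t) (sym (*-suc t _)) ⟩
      t * suc (degreeSumWithin S E)       ≤⟨ *-monoʳ-≤ t E<E' ⟩
      t * degreeSumWithin S E' ∎
      where open ≤-Reasoning

  extend-or-maximal : Maximal K ⊎ Σ[ K' ∈ Packing G S t ] degreeSumWithin S E < degreeSumWithin S (Packing.E K')
  extend-or-maximal with Fin.any? (λ u → Fin.any? (λ v → Fin.any? (λ y →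
      (S u Bool.≟ true) ×-dec (S v Bool.≟ true) ×-dec (¬? (u ≟ v)) ×-dec (E u v Bool.≟ false) ×-dec
      (ball {A = adj G} unused t u y Bool.≟ true) ×-dec (adj G y v Bool.≟ true))))
  ... | yes (u , v , y , Su , Sv , u≢v , ¬E , b , a) =
    let j , le , w = ball⇒walk unused t b in inj₂ (extend Su Sv u≢v ¬E le w a)
  ... | no none = inj₁ (λ Su Sv u≢v ¬E le w a → none (_ , _ , _ , Su , Sv , u≢v , ¬E , walk⇒ball le w , a))

-- Every extension raises the degree sum, which the density of depth-`t` minors caps at
-- `2 * c * countFin S`; the fuel is the remaining gap.
maximalPacking : ∀ {G S t c} → DensityBound G t c → Σ[ K ∈ Packing G S t ] Maximal K
maximalPacking {G} {S} {t} {c} dense = go _ (emptyPacking G S t) (m≤m+n _ _)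
  where
  go : ∀ fuel (K : Packing G S t) → 2 * c * countFin S ≤ fuel + degreeSumWithin S (Packing.E K) →
    Σ[ K ∈ Packing G S t ] Maximal K
  go fuel K le with extend-or-maximal K
  ... | inj₁ max = K , max
  go zero K le | inj₂ (K' , lt) =
    ⊥-elim (<-irrefl refl (<-≤-trans lt (≤-trans (minorModel-density c dense (Packing.model K')) le)))
  go (suc fuel) K le | inj₂ (K' , lt) = go fuel K' (≤-trans le
    (≤-trans (≤-reflexive (sym (+-suc fuel _))) (+-monoʳ-≤ fuel lt)))

-- Vertices shielded from the rest by bounded sets

record Shielded (G : Graph) (k d : ℕ) (v : Fin (size G)) (Out : Fin (size G) → Bool) : Set where
  field
    Z       : Fin (size G) → Bool
    Z-small : countFin Z ≤ d
    -- The case `y ≡ v` allows for a step back to the start, the only vertex of the walk not known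
    -- to lie in `Out`.
    exit    : ∀ {x y j} → j ≤ k → Walk (adj G) (λ z → Out z ≡ true) v j x → adj G x y ≡ true →
              y ≡ v ⊎ Out y ≡ true ⊎ Z y ≡ true

-- The degree bound `2 * c₂` of the ball minor, times the order of that minor relative to `R`: `M`
-- has at most `(k + k) * (2 * c₁)` vertices per vertex of `S`, and `S` at most `suc (2 * c₁)` per
-- vertex of `R`.
shieldSize : ℕ → ℕ → ℕ → ℕ
shieldSize k c₁ c₂ = 2 * c₂ * (suc ((k + k) * (2 * c₁)) * suc (2 * c₁))

shieldSize-arith : ∀ {u s m r δ} t a → u ≤ s + m → m ≤ t * δ → δ ≤ a * s → s ≤ suc a * r →
  u ≤ suc (t * a) * suc a * r
shieldSize-arith {u} {s} {m} {r} {δ} t a u≤ m≤ δ≤ s≤ = begin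
  u                             ≤⟨ u≤ ⟩
  s + m                         ≤⟨ +-monoʳ-≤ s (≤-trans m≤ (*-monoʳ-≤ t δ≤)) ⟩
  s + t * (a * s)               ≡⟨ cong (s +_) (sym (*-assoc t a s)) ⟩
  suc (t * a) * s               ≤⟨ *-monoʳ-≤ (suc (t * a)) s≤ ⟩
  suc (t * a) * (suc a * r)     ≡⟨ sym (*-assoc (suc (t * a)) (suc a) r) ⟩
  suc (t * a) * suc a * r ∎
  where open ≤-Reasoning

-- Balls around an independent set R of the minor given by a maximal packing are disjoint
-- outside S ∪ M, so together with the single vertices of S ∪ M they form a minor.
module BallMinor {G : Graph} {S : Fin (size G) → Bool} {k : ℕ} (K : Packing G S (k + k)) (maximal : Maximal K)
         (R : Fin (size G) → Bool) (R⊆S : ∀ x → R x ≡ true → S x ≡ true) (R-indep : Independent (Packing.E K) R) where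
  open Packing K

  private
    V : Set
    V = Fin (size G)

  U : V → Bool
  U x = S x ∨ M x
  B : Rel (size G)
  B = ball {A = adj G} unused k
  touches F branch' : Rel (size G)
  touches v y = anyFin (λ x → B v x ∧ adj G x y)
  -- Contact of the ball at a member of `R` with the other vertex itself, not with a ball around it:
  -- these are the exits to be counted.
  F x y = not (eqFin x y) ∧ ((R x ∧ touches x y) ∨ (R y ∧ touches y x))
  branch' u x = if R u then B u x else eqFin u x

  -- Edges move from the end of the second walk to the first until the second is a single edge at
  -- `v`. The total stays at most `k + k`, so the first walk with that edge is a connection excluded
  -- by maximality. This is why the packing has parameter `k + k`.
  walks-meet : ∀ {u v x i j} → S u ≡ true → S v ≡ true → u ≢ v → E u v ≡ false → i + j ≤ k + k →
    Walk (adj G) (λ z → unused z ≡ true) u i x → Walk (adj G) (λ z → unused z ≡ true) v j x → ⊥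
  walks-meet Su Sv u≢v ¬E le here here = u≢v refl
  walks-meet Su Sv u≢v ¬E le (step _ _ p) here = unused⇒¬S p Sv
  walks-meet {i = i} Su Sv u≢v ¬E le w (step here a _) =
    maximal Su Sv u≢v ¬E (≤-trans (m≤m+n i 1) le) w (trans (adjSym G _ _) a)
  walks-meet {i = i} Su Sv u≢v ¬E le w (step w'@(step _ _ p) a _) =
    walks-meet Su Sv u≢v ¬E (≤-trans (≤-reflexive (sym (+-suc i _))) le) (step w (trans (adjSym G _ _) a) p) w'

  ball∩U : ∀ {u x} → B u x ≡ true → U x ≡ true → x ≡ u
  ball∩U b Ux with ball⇒walk unused k b
  ... | _ , _ , here       = refl
  ... | _ , _ , step _ _ p = ⊥-elim (true≢false Ux (not-true⇒false p))

  disjoint' : ∀ u v x → U u ≡ true → U v ≡ true → branch' u x ≡ true → branch' v x ≡ true → u ≡ v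
  disjoint' u v x Uu Uv p q with R u in Ru | R v in Rv
  ... | false | false = trans (eqFin⇒≡ p) (sym (eqFin⇒≡ q))
  ... | true  | false = ⊥-elim (true≢false (subst (λ z → R z ≡ true) (sym v≡u) Ru) Rv)
    where v≡u = ball∩U (subst (λ z → B u z ≡ true) (sym (eqFin⇒≡ q)) p) Uv
  ... | false | true  = ⊥-elim (true≢false (subst (λ z → R z ≡ true) (sym u≡v) Rv) Ru)
    where u≡v = ball∩U (subst (λ z → B v z ≡ true) (sym (eqFin⇒≡ p)) q) Uu
  ... | true  | true with u ≟ v
  ...   | yes eq = eq
  ...   | no u≢v = let i , i≤ , w = ball⇒walk unused k p
                       j , j≤ , w' = ball⇒walk unused k q
                   in ⊥-elim (walks-meet (R⊆S u Ru) (R⊆S v Rv) u≢v (R-indep u v Ru Rv) (+-mono-≤ i≤ j≤) w w')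

  self' : ∀ u → branch' u u ≡ true
  self' u with R u
  ... | true  = ball-center unused k u
  ... | false = eqFin-refl u

  radius' : ∀ u x → branch' u x ≡ true → Σ[ j ∈ ℕ ] (j ≤ k × Walk (adj G) (λ z → branch' u z ≡ true) u j x)
  radius' u x p with R u
  ... | false = 0 , z≤n , subst (Walk (adj G) _ u 0) (eqFin⇒≡ p) here
  ... | true  = let j , le , w = ball⇒walk unused k p in j , le , within le w
    where
    within : ∀ {j x} → j ≤ k → Walk (adj G) (λ z → unused z ≡ true) u j x → Walk (adj G) (λ z → B u z ≡ true) u j x
    within le here             = here
    within le w@(step w' a p') = step (within (≤-trans (n≤1+n _) le) w') a (walk⇒ball le w)

  touch-edge : ∀ u v → R u ≡ true → touches u v ≡ true →
    Σ[ x ∈ V ] (branch' u x ≡ true × adj G x v ≡ true)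
  touch-edge u v Ru p with R u
  touch-edge u v refl p | .true = let x , q = anyFin-elim (λ x → B u x ∧ adj G x v) p in x , ∧-split q

  edges' : ∀ u v → F u v ≡ true → Σ[ x ∈ V ] Σ[ y ∈ V ] (branch' u x ≡ true × branch' v y ≡ true × adj G x y ≡ true)
  edges' u v p with ∨-split (proj₂ (∧-split {not (eqFin u v)} p))
  ... | inj₁ q = let Ru , t = ∧-split q
                     x , b , a = touch-edge u v Ru t
                 in x , v , b , self' v , a
  ... | inj₂ q = let Rv , t = ∧-split q
                     x , b , a = touch-edge v u Rv t
                 in u , x , self' u , b , trans (adjSym G u x) a

  model' : MinorModel G k U F branch'
  model' = record
    { E-sym = λ u v → cong₂ _∧_ (cong not (eqFin-sym u v)) (Bool.∨-comm (R u ∧ touches u v) (R v ∧ touches v u))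
    ; E-irrefl = λ u → cong (λ b → not b ∧ ((R u ∧ touches u u) ∨ (R u ∧ touches u u))) (eqFin-refl u)
    ; disjoint = disjoint'
    ; self = λ u _ → self' u
    ; radius = λ u x _ → radius' u x
    ; edges = λ u v _ _ → edges' u v }

  ball-exit : ∀ {v x y j} → R v ≡ true → j ≤ k → Walk (adj G) (λ z → unused z ≡ true) v j x → adj G x y ≡ true →
    y ≡ v ⊎ unused y ≡ true ⊎ (U y ∧ F v y) ≡ true
  ball-exit {v} {x} {y} Rv le w a with y ≟ v | true-or-false (U y)
  ... | yes y≡v | _       = inj₁ y≡v
  ... | no _    | inj₂ ¬U = inj₂ (inj₁ (false⇒not-true ¬U))
  ... | no y≢v  | inj₁ Uy = inj₂ (inj₂ (∧-join Uy (∧-join (false⇒not-true (≢⇒eqFin (y≢v ∘ sym)))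
    (∨-inl (∧-join Rv (anyFin-intro (λ z → B v z ∧ adj G z y) x (∧-join (walk⇒ball le w) a)))))))

  degU : V → ℕ
  degU x = countFin (λ y → U y ∧ F x y)

  R-pos : ∀ c → 0 < countFin S → countFin S ≤ suc c * countFin R → 0 < countFin R
  R-pos c S-pos S≤R = n≢0⇒n>0 (λ eq → n≮0 (<-≤-trans S-pos
    (≤-trans S≤R (≤-reflexive (trans (cong (suc c *_) eq) (*-zeroʳ (suc c)))))))

  -- The ball minor is sparse on `U`, and `U` is larger than `R` by a constant factor only, so the
  -- average degree over `R` is bounded.
  R-degreeSum : ∀ c₁ c₂ → DensityBound G (k + k) c₁ → DensityBound G k c₂ → countFin S ≤ suc (2 * c₁) * countFin R →
    sumFin (λ x → if R x then degU x else 0) ≤ shieldSize k c₁ c₂ * countFin R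
  R-degreeSum c₁ c₂ dense₁ dense₂ S≤R = begin
    sumFin (λ x → if R x then degU x else 0)   ≤⟨ sumFin-mono R≤U ⟩
    degreeSumWithin U F                        ≤⟨ minorModel-density c₂ dense₂ model' ⟩
    2 * c₂ * countFin U                        ≤⟨ *-monoʳ-≤ (2 * c₂) (shieldSize-arith {r = countFin R} (k + k) (2 * c₁)
      (countFin-∨ S M) M-size (minorModel-density c₁ dense₁ model) S≤R) ⟩
    2 * c₂ * (suc ((k + k) * (2 * c₁)) * suc (2 * c₁) * countFin R)
      ≡⟨ sym (*-assoc (2 * c₂) (suc ((k + k) * (2 * c₁)) * suc (2 * c₁)) (countFin R)) ⟩
    shieldSize k c₁ c₂ * countFin R ∎
    where
    open ≤-Reasoning
    R≤U : ∀ x → (if R x then degU x else 0) ≤ (if U x then degU x else 0)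
    R≤U x with R x in Rx
    ... | false = z≤n
    ... | true rewrite R⊆S x Rx = ≤-refl

  shielded-in-R : ∀ c₁ c₂ → DensityBound G (k + k) c₁ → DensityBound G k c₂ →
    0 < countFin S → countFin S ≤ suc (2 * c₁) * countFin R →
    Σ[ v ∈ V ] (S v ≡ true × Σ[ Out ∈ (V → Bool) ]
      ((∀ u → S u ≡ true → Out u ≡ false) × Shielded G k (shieldSize k c₁ c₂) v Out))
  shielded-in-R c₁ c₂ dense₁ dense₂ S-pos S≤R =
    let v , Rv , degree≤ = exists≤average R degU (shieldSize k c₁ c₂) (R-pos (2 * c₁) S-pos S≤R) (R-degreeSum c₁ c₂ dense₁ dense₂ S≤R)
    in v , R⊆S v Rv , unused , (λ u Su → ¬true⇒false (λ p → unused⇒¬S p Su)) , record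
      { Z = λ y → U y ∧ F v y ; Z-small = degree≤ ; exit = ball-exit Rv }

exists-shielded : ∀ {G} k c₁ c₂ → DensityBound G (k + k) c₁ → DensityBound G k c₂ →
  ∀ S → 0 < countFin S →
  Σ[ v ∈ Fin (size G) ] (S v ≡ true × Σ[ Out ∈ (Fin (size G) → Bool) ]
    ((∀ u → S u ≡ true → Out u ≡ false) × Shielded G k (shieldSize k c₁ c₂) v Out))
exists-shielded k c₁ c₂ dense₁ dense₂ S S-pos =
  let K , maximal = maximalPacking {S = S} {t = k + k} {c = c₁} dense₁
      open Packing K
      R , R⊆S , R-indep , S≤R = independent-set E (2 * c₁) (MinorModel.E-sym model) (MinorModel.E-irrefl model) S
        (λ V V⊆S → minorModel-density c₁ dense₁ (minorModel-⊆ V⊆S model))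
  in BallMinor.shielded-in-R {k = k} K maximal R R⊆S R-indep c₁ c₂ dense₁ dense₂ S-pos S≤R

-- Weak reachability

-- Vertices removed earlier get larger `L`. Among members of `S`, `past` confines `Out v` to those
-- removed before `v`.
record DegenerateOrder (G : Graph) (k d : ℕ) (S : Fin (size G) → Bool) : Set where
  field
    L      : Fin (size G) → ℕ
    Out    : Rel (size G)
    L<     : ∀ {v} → S v ≡ true → L v < countFin S
    L-inj  : ∀ {u v} → S u ≡ true → S v ≡ true → L u ≡ L v → u ≡ v
    past   : ∀ {u v} → S u ≡ true → S v ≡ true → L u ≤ L v → Out v u ≡ false
    shield : ∀ {v} → S v ≡ true → Shielded G k d v (Out v)

exists-degenerateOrder : ∀ {G k d} →
  (∀ S → 0 < countFin S → Σ[ v ∈ Fin (size G) ] (S v ≡ true × Σ[ Out ∈ (Fin (size G) → Bool) ]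
    ((∀ u → S u ≡ true → Out u ≡ false) × Shielded G k d v Out))) →
  ∀ S → DegenerateOrder G k d S
exists-degenerateOrder {G} {k} {d} choose S = go (countFin S) S ≤-refl
  where
  go : ∀ fuel S → countFin S ≤ fuel → DegenerateOrder G k d S
  go fuel S le with countFin S ≤? 0
  ... | yes empty = record
    { L = λ _ → 0 ; Out = λ _ _ → false ; L< = λ p → ⊥-elim (none p) ; L-inj = λ p → ⊥-elim (none p)
    ; past = λ p → ⊥-elim (none p) ; shield = λ p → ⊥-elim (none p) }
    where
    none : ∀ {v} → S v ≡ true → ⊥
    none p = n≮0 (<-≤-trans (countFin-pos {U = S} _ p) empty)
  go zero S le | no nonempty = ⊥-elim (nonempty le)
  go (suc fuel) S le | no nonempty with choose S (≰⇒> nonempty)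
  ... | v , Sv , Outᵥ , Outᵥ∩S , shieldᵥ = record
    { L = L ; Out = Out ; L< = L< ; L-inj = L-inj ; past = past ; shield = shield }
    where
    S' : Fin (size G) → Bool
    S' x = S x ∧ not (eqFin v x)
    S'<S : countFin S' < countFin S
    S'<S = countFin-mono-< (λ x → proj₁ ∘ ∧-split) v
      (¬true⇒false (λ p → true≢false (eqFin-refl v) (not-true⇒false (proj₂ (∧-split {S v} p))))) Sv
    rest = go fuel S' (≤-pred (≤-trans S'<S le))
    module R = DegenerateOrder rest
    S'-intro : ∀ {x} → S x ≡ true → v ≢ x → S' x ≡ true
    S'-intro p ne = ∧-join p (false⇒not-true (≢⇒eqFin ne))
    L : Fin (size G) → ℕ
    L x with v ≟ x
    -- The vertex removed now comes above all that remain, whose values are below `countFin S'`.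
    ... | yes _ = countFin S'
    ... | no  _ = R.L x
    Out : Rel (size G)
    Out x with v ≟ x
    ... | yes _ = Outᵥ
    ... | no  _ = R.Out x
    L< : ∀ {x} → S x ≡ true → L x < countFin S
    L< {x} p with v ≟ x
    ... | yes _ = S'<S
    ... | no ne = <-trans (R.L< (S'-intro p ne)) S'<S
    L-inj : ∀ {x y} → S x ≡ true → S y ≡ true → L x ≡ L y → x ≡ y
    L-inj {x} {y} p q eq with v ≟ x | v ≟ y
    ... | yes e | yes e' = trans (sym e) e'
    ... | yes e | no ne  = ⊥-elim (<⇒≢ (R.L< (S'-intro q ne)) (sym eq))
    ... | no ne | yes e  = ⊥-elim (<⇒≢ (R.L< (S'-intro p ne)) eq)
    ... | no ne | no ne' = R.L-inj (S'-intro p ne) (S'-intro q ne') eq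
    past : ∀ {x y} → S x ≡ true → S y ≡ true → L x ≤ L y → Out y x ≡ false
    past {x} {y} p q le with v ≟ y | v ≟ x
    ... | yes _ | _      = Outᵥ∩S x p
    ... | no ne | yes e  = ⊥-elim (<⇒≱ (R.L< (S'-intro q ne)) le)
    ... | no ne | no ne' = R.past (S'-intro p ne') (S'-intro q ne) le
    shield : ∀ {x} → S x ≡ true → Shielded G k d x (Out x)
    shield {x} p with v ≟ x
    ... | yes refl = shieldᵥ
    ... | no ne    = R.shield (S'-intro p ne)

-- By `covers`, `hub v` lists all vertices weakly `k`-reachable from `v`. It may list others, so `w`
-- is an upper bound for the weak colouring number.
record WeakReach (G : Graph) (k w : ℕ) : Set where
  field
    L        : Fin (size G) → ℕ
    height   : ℕ
    L<height : ∀ v → L v < height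
    L-inj    : ∀ {u v} → L u ≡ L v → u ≡ v
    hub      : Fin (size G) → Fin w → Fin (size G)
    covers   : ∀ {j v y} → j ≤ k → L y ≤ L v → Walk (adj G) (λ x → L y ≤ L x) v j y →
               Σ[ e ∈ Fin w ] hub v e ≡ y

-- The number of nodes of a `d`-ary tree of depth `k`: `v` itself, and for each of `d` shielding
-- vertices its hubs for one step less.
hubCount : ℕ → ℕ → ℕ
hubCount d zero    = 1
hubCount d (suc k) = suc (d * hubCount d k)

-- A walk from v to y with minimum y either ends at v or meets the set Z shielding v,
-- after which fewer than k steps remain.
weakReach : ∀ {G k d} → DegenerateOrder G k d (λ _ → true) → WeakReach G k (hubCount d k)
weakReach {G} {k} {d} order = record
  { L = L ; height = countFin {size G} (λ _ → true) ; L<height = λ v → L< refl ; L-inj = L-inj refl refl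
  ; hub = hub k ; covers = hub-covers k ≤-refl }
  where
  open DegenerateOrder order
  module Sh v = Shielded (shield {v} refl)
  z : Fin (size G) → Fin d → Fin (size G)
  z v = proj₁ (cover (Sh.Z v) (Sh.Z-small v) v)
  hub : ∀ i → Fin (size G) → Fin (hubCount d i) → Fin (size G)
  hub zero    v _       = v
  hub (suc i) v zero    = v
  hub (suc i) v (suc e) = hub i (z v (proj₁ (remQuot {d} (hubCount d i) e))) (proj₂ (remQuot {d} (hubCount d i) e))
  hub-self : ∀ i v → Σ[ e ∈ Fin (hubCount d i) ] hub i v e ≡ v
  hub-self zero    v = zero , refl
  hub-self (suc i) v = zero , refl
  hub-next : ∀ i v a b → hub (suc i) v (suc (combine a b)) ≡ hub i (z v a) b
  hub-next i v a b = cong (λ p → hub i (z v (proj₁ p)) (proj₂ p)) (Fin.remQuot-combine {d} {hubCount d i} a b)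
  -- Either the walk shortens to one inside `Out v`, a return to `v` restarting it, or it meets `Z`
  -- and the rest from there is strictly shorter.
  follow : ∀ {j v y x} → j ≤ k → Walk (adj G) (λ x → L y ≤ L x) v j x →
    (Σ[ i ∈ ℕ ] (i ≤ j × Walk (adj G) (λ x → Out v x ≡ true) v i x)) ⊎
    (Σ[ z ∈ Fin (size G) ] Σ[ i ∈ ℕ ]
      (suc i ≤ j × Sh.Z v z ≡ true × L y ≤ L z × Walk (adj G) (λ x → L y ≤ L x) z i x))
  follow le here = inj₁ (0 , z≤n , here)
  follow {v = v} le (step {y = x} w a p) with follow (≤-trans (n≤1+n _) le) w
  ... | inj₂ (z , i , i<j , Zz , yz , w') = inj₂ (z , suc i , s≤s i<j , Zz , yz , step w' a p)
  ... | inj₁ (i , i≤j , w') with Sh.exit v (≤-trans i≤j (≤-trans (n≤1+n _) le)) w' a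
  ...   | inj₁ refl        = inj₁ (0 , z≤n , here)
  ...   | inj₂ (inj₁ out) = inj₁ (suc i , s≤s i≤j , step w' a out)
  ...   | inj₂ (inj₂ Zx)  = inj₂ (x , 0 , s≤s z≤n , Zx , p , here)
  hub-covers : ∀ i → i ≤ k → ∀ {j v y} → j ≤ i → L y ≤ L v → Walk (adj G) (λ x → L y ≤ L x) v j y →
    Σ[ e ∈ Fin (hubCount d i) ] hub i v e ≡ y
  hub-covers i i≤k {v = v} j≤i y≤v w with follow (≤-trans j≤i i≤k) w
  ... | inj₁ (_ , _ , here) = hub-self i v
  -- Here `y` would lie in `Out v` although `L y ≤ L v`.
  ... | inj₁ (_ , _ , step _ _ out) = ⊥-elim (true≢false out (past refl refl y≤v))
  hub-covers zero i≤k z≤n y≤v w | inj₂ (_ , _ , () , _)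
  hub-covers (suc i) i≤k {v = v} j≤i y≤v w | inj₂ (x , j' , j'<j , Zx , y≤x , w') =
    let a , za = proj₂ (cover (Sh.Z v) (Sh.Z-small v) v) x Zx
        b , hb = hub-covers i (≤-trans (n≤1+n i) i≤k) (≤-pred (≤-trans j'<j j≤i)) y≤x w'
    in suc (combine a b) , trans (hub-next i v a b) (trans (cong (λ u → hub i u b) za) hb)

-- Vertices are coloured by increasing `L`; each has `w` hubs to avoid, so one of `suc w` colours is
-- free.
greedyColoring : ∀ {n w} (L : Fin n → ℕ) height → (∀ v → L v < height) → (hub : Fin n → Fin w → Fin n) →
  Σ[ χ ∈ (Fin n → Fin (suc w)) ] (∀ v e → L (hub v e) < L v → χ (hub v e) ≢ χ v)
greedyColoring {n} {w} L height L<height hub = let χ , ok = go height in χ , λ v e → ok v e (L<height v)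
  where
  go : ∀ b → Σ[ χ ∈ (Fin n → Fin (suc w)) ] (∀ v e → L v < b → L (hub v e) < L v → χ (hub v e) ≢ χ v)
  go zero = (λ _ → zero) , λ _ _ ()
  go (suc b) = χ' , ok'
    where
    χ = proj₁ (go b)
    ok = proj₂ (go b)
    new : ∀ v → Σ[ c ∈ Fin (suc w) ] (∀ e → χ (hub v e) ≢ c)
    new v = fresh (χ ∘ hub v)
    χ' : Fin n → Fin (suc w)
    χ' v with L v ℕ.≟ b
    ... | yes _ = proj₁ (new v)
    ... | no  _ = χ v
    ok' : ∀ v e → L v < suc b → L (hub v e) < L v → χ' (hub v e) ≢ χ' v
    ok' v e v≤b lt with L (hub v e) ℕ.≟ b | L v ℕ.≟ b
    ... | yes eq | _     = ⊥-elim (<⇒≢ (<-≤-trans lt (≤-pred v≤b)) eq)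
    ... | no _   | yes _ = proj₂ (new v) e
    ... | no _   | no ne = ok v e (≤∧≢⇒< (≤-pred v≤b) ne) lt

weakColoringNumber : ∀ {C} → BoundedExpansion C → ℕ → ℕ
weakColoringNumber be k = hubCount (shieldSize k (proj₁ (be (k + k))) (proj₁ (be k))) k

weakReach-bounded : ∀ {C} (be : BoundedExpansion C) k {G} → C G → WeakReach G k (weakColoringNumber be k)
weakReach-bounded be k {G} CG = weakReach (exists-degenerateOrder
  (exists-shielded k (proj₁ (be (k + k))) (proj₁ (be k)) (λ H → proj₂ (be (k + k)) G H CG) (λ H → proj₂ (be k) G H CG)) (λ _ → true))

-- Bounded tree-depth of unions of colour classes

record WeakColoring (G : Graph) (K c : ℕ) : Set where
  field
    L        : Fin (size G) → ℕ
    height   : ℕ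
    L<height : ∀ v → L v < height
    L-inj    : ∀ {u v} → L u ≡ L v → u ≡ v
    χ        : Fin (size G) → Fin c
    distinct : ∀ {j v y} → j ≤ K → L y < L v → Walk (adj G) (λ x → L y ≤ L x) v j y → χ y ≢ χ v

weakColoring : ∀ {G K w} → WeakReach G K w → WeakColoring G K (suc w)
weakColoring R = record
  { L = L ; height = height ; L<height = L<height ; L-inj = L-inj ; χ = proj₁ greedy
  ; distinct = λ {j} {v} le lt w → let e , eq = covers le (<⇒≤ lt) w
               in subst (λ y → L y < L v → proj₁ greedy y ≢ proj₁ greedy v) eq (proj₂ greedy v e) lt }
  where
  open WeakReach R
  greedy = greedyColoring L height L<height hub

argmin : ∀ (g : ℕ → ℕ) {a} b → a < b → Σ[ m ∈ ℕ ] (a ≤ m × m < b × (∀ i → a ≤ i → i < b → g m ≤ g i))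
argmin g {a} (suc b) (s≤s a≤b) with m≤n⇒m<n∨m≡n a≤b
... | inj₂ refl = a , ≤-refl , ≤-refl , λ i p q → ≤-reflexive (cong g (≤-antisym p (≤-pred q)))
... | inj₁ a<b with argmin g b a<b
...   | m , a≤m , m<b , min with ≤-total (g m) (g b)
...     | inj₁ le = m , a≤m , m≤n⇒m≤1+n m<b , λ i p q → [ min i p , (λ { refl → le }) ]′ (m≤n⇒m<n∨m≡n (≤-pred q))
...     | inj₂ ge = b , a≤b , ≤-refl ,
  λ i p q → [ (λ lt → ≤-trans ge (min i p lt)) , (λ { refl → ≤-refl }) ]′ (m≤n⇒m<n∨m≡n (≤-pred q))

module _ {G : Graph} {K c : ℕ} (col : WeakColoring G K c) where
  open WeakColoring col

  -- The minimum of a path with 2^(j+1) vertices has a colour that occurs only once on the path,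
  -- and one of the two halves of the path avoids it.
  module _ (f : ℕ → Fin (size G)) (B : ℕ) (B≤K : B ≤ K)
           (f-adj : ∀ i → suc i < B → adj G (f i) (f (suc i)) ≡ true)
           (f-inj : ∀ i j → i < B → j < B → f i ≡ f j → i ≡ j) where

    -- The subpath from `f i` to `f m` shows that `f m` is weakly reachable from `f i`, and it is
    -- shorter than `B`, hence within `K`.
    min-color-unique : ∀ lo hi → hi ≤ B → ∀ m i → lo ≤ m → m < hi → lo ≤ i → i < hi → i ≢ m →
      (∀ x → lo ≤ x → x < hi → L (f m) ≤ L (f x)) → χ (f m) ≢ χ (f i)
    min-color-unique lo hi hi≤B m i lo≤m m<hi lo≤i i<hi i≢m min = distinct len≤K
      (≤∧≢⇒< (min i lo≤i i<hi) (λ eq → i≢m (f-inj i m (<-≤-trans i<hi hi≤B) (<-≤-trans m<hi hi≤B) (sym (L-inj eq))))) (proj₂ (proj₂ walk))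
      where
      P : Fin (size G) → Set
      P x = L (f m) ≤ L x
      steps : ∀ {a b} → lo ≤ a → b < hi → ∀ x → a ≤ x → x < b → adj G (f x) (f (suc x)) ≡ true × P (f (suc x))
      steps lo≤a b<hi x a≤x x<b = f-adj x (<-≤-trans (≤-<-trans x<b b<hi) hi≤B) ,
        min (suc x) (≤-trans lo≤a (≤-trans a≤x (n≤1+n x))) (≤-<-trans x<b b<hi)
      forward : ∀ {a b} → lo ≤ a → b < hi → a ≤ b → Walk (adj G) P (f a) (b ∸ a) (f b)
      forward {a} {b} lo≤a b<hi a≤b = subst (λ x → Walk (adj G) P (f a) (b ∸ a) (f x)) (m∸n+n≡m a≤b)
        (segment f a (b ∸ a) (λ x a≤x x<b → steps lo≤a b<hi x a≤x (subst (x <_) (m∸n+n≡m a≤b) x<b)))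
      short : ∀ {a b} → b < hi → b ∸ a ≤ K
      short {a} {b} b<hi = ≤-trans (m∸n≤m b a) (≤-trans (<⇒≤ (<-≤-trans b<hi hi≤B)) B≤K)
      walk : Σ[ len ∈ ℕ ] (len ≤ K × Walk (adj G) P (f i) len (f m))
      walk with ≤-total i m
      ... | inj₁ i≤m = m ∸ i , short {i} m<hi , forward lo≤i m<hi i≤m
      ... | inj₂ m≤i = i ∸ m , short {m} i<hi , walk-reverse (adjSym G) ≤-refl (forward lo≤m i<hi m≤i)
      len≤K = proj₁ (proj₂ walk)

    no-long-path : ∀ j a (Cs : Fin c → Bool) → countFin Cs ≤ j → 2 ^ j + a ≤ B →
      (∀ i → a ≤ i → i < 2 ^ j + a → Cs (χ (f i)) ≡ true) → ⊥
    no-long-path zero a Cs few le colors = n≮0 (<-≤-trans (countFin-pos {U = Cs} _ (colors a ≤-refl ≤-refl)) few)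
    no-long-path (suc j) a Cs few le colors
      with argmin (L ∘ f) (2 ^ suc j + a) (m<n+m a (m^n>0 2 (suc j)))
    ... | m , a≤m , m<hi , min = half (m <? 2 ^ j + a)
      where
      Cs' : Fin c → Bool
      Cs' x = Cs x ∧ not (eqFin (χ (f m)) x)
      few' : countFin Cs' ≤ j
      few' = ≤-pred (≤-trans (countFin-mono-< (λ x → proj₁ ∘ ∧-split) (χ (f m))
        (¬true⇒false (λ p → true≢false (eqFin-refl (χ (f m))) (not-true⇒false (proj₂ (∧-split {Cs (χ (f m))} p)))))
        (colors m a≤m m<hi)) few)
      colors' : ∀ i → a ≤ i → i < 2 ^ suc j + a → i ≢ m → Cs' (χ (f i)) ≡ true
      colors' i a≤i i<hi i≢m = ∧-join (colors i a≤i i<hi)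
        (false⇒not-true (≢⇒eqFin (min-color-unique a (2 ^ suc j + a) le m i a≤m m<hi a≤i i<hi i≢m min)))
      double : 2 ^ j + (2 ^ j + a) ≡ 2 ^ suc j + a
      double = trans (sym (+-assoc (2 ^ j) (2 ^ j) a)) (cong (λ x → 2 ^ j + x + a) (sym (+-identityʳ (2 ^ j))))
      mid≤hi : 2 ^ j + a ≤ 2 ^ suc j + a
      mid≤hi = subst (2 ^ j + a ≤_) double (m≤n+m _ (2 ^ j))
      half : Dec (m < 2 ^ j + a) → ⊥
      half (yes m<mid) = no-long-path j (2 ^ j + a) Cs' few' (subst (_≤ B) (sym double) le)
        (λ i mid≤i i<hi → colors' i (≤-trans (m≤n+m a (2 ^ j)) mid≤i) (subst (i <_) double i<hi)
          (λ { refl → <⇒≱ m<mid mid≤i }))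
      half (no m≮mid) = no-long-path j a Cs' few' (≤-trans mid≤hi le)
        (λ i a≤i i<mid → colors' i a≤i (<-≤-trans i<mid mid≤hi) (λ { refl → m≮mid i<mid }))

  module Union (q : ℕ) (2^q≤K : 2 ^ q ≤ K) (cols : Fin q → Fin c) where

    inCols : Fin c → Bool
    inCols x = anyFin (λ j → eqFin (cols j) x)

    Y : Fin (size G) → Bool
    Y v = inCols (χ v)

    few-cols : countFin inCols ≤ q
    few-cols = countFin-upper inCols (λ x p → proj₁ (index x p))
      (λ x y p p' eq → trans (sym (eqFin⇒≡ (proj₂ (index x p))))
                      (trans (cong cols eq) (eqFin⇒≡ (proj₂ (index y p')))))
      where
      index : ∀ x → inCols x ≡ true → Σ[ j ∈ Fin q ] eqFin (cols j) x ≡ true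
      index x = anyFin-elim (λ j → eqFin (cols j) x)

    -- The first `2 ^ q` positions cannot all be distinct, as they would form a path with at most
    -- `q` colours; the loop between two equal positions is cut out.
    shorten : ∀ {P u j v} → (∀ x → P x → Y x ≡ true) → P u → 2 ^ q ≤ suc j → Walk (adj G) P u j v →
      Σ[ i ∈ ℕ ] (i < j × Walk (adj G) P u i v)
    shorten {P} {u} {j} {v} P⊆Y Pu long w
      with Fin.any? {n = 2 ^ q} (λ x → Fin.any? {n = 2 ^ q} (λ y →
             (toℕ x <? toℕ y) ×-dec (vertexAt w (toℕ x) ≟ vertexAt w (toℕ y))))
    ... | yes (x , y , x<y , same) = toℕ x + (j ∸ toℕ y) ,
      <-≤-trans (+-monoˡ-< (j ∸ toℕ y) x<y) (≤-reflexive (m+[n∸m]≡n y≤j)) ,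
      subst (λ z → Walk (adj G) P z _ v) (vertexAt-start w) (walk-++ first (subst (λ z → Walk (adj G) P z _ v) (sym same) second))
      where
      f : ℕ → Fin (size G)
      f = vertexAt w
      y≤j : toℕ y ≤ j
      y≤j = ≤-pred (≤-trans (Fin.toℕ<n y) long)
      first : Walk (adj G) P (f 0) (toℕ x) (f (toℕ x))
      first = subst (λ z → Walk (adj G) P (f 0) (toℕ x) (f z)) (+-identityʳ (toℕ x))
        (segment f 0 (toℕ x) (λ i _ i<x → vertexAt-adj w
          (<-≤-trans (subst (i <_) (+-identityʳ (toℕ x)) i<x) (≤-trans (<⇒≤ x<y) y≤j))))
      second : Walk (adj G) P (f (toℕ y)) (j ∸ toℕ y) v
      second = subst (Walk (adj G) P (f (toℕ y)) (j ∸ toℕ y)) (trans (cong f (m∸n+n≡m y≤j)) (vertexAt-end w))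
        (segment f (toℕ y) (j ∸ toℕ y) (λ i _ i<j → vertexAt-adj w (subst (i <_) (m∸n+n≡m y≤j) i<j)))
    ... | no none = ⊥-elim (no-long-path f (2 ^ q) 2^q≤K
        (λ i lt → proj₁ (vertexAt-adj w (≤-pred (≤-trans lt long)))) f-inj
        q 0 inCols few-cols (≤-reflexive (+-identityʳ (2 ^ q)))
        (λ i _ lt → P⊆Y _ (f-P i (≤-pred (≤-trans (subst (i <_) (+-identityʳ (2 ^ q)) lt) long)))))
      where
      f : ℕ → Fin (size G)
      f = vertexAt w
      f-P : ∀ i → i ≤ j → P (f i)
      f-P zero    _  = subst P (sym (vertexAt-start w)) Pu
      f-P (suc i) lt = proj₂ (vertexAt-adj w lt)
      different : ∀ x y → x < y → (y<B : y < 2 ^ q) → f x ≢ f y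
      different x y x<y y<B eq = none (fromℕ< (<-trans x<y y<B) , fromℕ< y<B ,
        subst₂ _<_ (sym (Fin.toℕ-fromℕ< _)) (sym (Fin.toℕ-fromℕ< _)) x<y ,
        trans (cong f (Fin.toℕ-fromℕ< _)) (trans eq (cong f (sym (Fin.toℕ-fromℕ< _)))))
      f-inj : ∀ x y → x < 2 ^ q → y < 2 ^ q → f x ≡ f y → x ≡ y
      f-inj x y x<B y<B eq with <-cmp x y
      ... | tri< lt _ _ = ⊥-elim (different x y lt y<B eq)
      ... | tri≈ _ e _  = e
      ... | tri> _ _ gt = ⊥-elim (different y x gt x<B (sym eq))

    -- This bound lets a ball of fixed radius decide `anc`, and it keeps walks within the range `K`
    -- of `distinct`.
    short-walk : ∀ {P u v} → (∀ x → P x → Y x ≡ true) → P u → ∀ {j} → Walk (adj G) P u j v →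
      Σ[ i ∈ ℕ ] (i ≤ 2 ^ q × Walk (adj G) P u i v)
    short-walk {P} {u} {v} P⊆Y Pu {j} w = go j ≤-refl w
      where
      go : ∀ fuel {j} → j ≤ fuel → Walk (adj G) P u j v → Σ[ i ∈ ℕ ] (i ≤ 2 ^ q × Walk (adj G) P u i v)
      go fuel {j} le w with j ≤? 2 ^ q
      ... | yes small = j , small , w
      go zero z≤n w | no big = ⊥-elim (big z≤n)
      go (suc fuel) {j} le w | no big =
        let i , i<j , w' = shorten P⊆Y Pu (≤-trans (<⇒≤ (≰⇒> big)) (n≤1+n j)) w
        in go fuel (≤-pred (≤-trans i<j le)) w'

    Above : Fin (size G) → Fin (size G) → Set
    Above w x = Y x ≡ true × L w ≤ L x

    -- The ancestors of v in an elimination forest of G[Y].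
    anc : Rel (size G)
    anc v w = Y w ∧ ball {A = adj G} (λ x → Y x ∧ (L w ≤ᵇ L x)) (2 ^ q) w v

    anc-intro : ∀ {v w j} → Y w ≡ true → Walk (adj G) (Above w) w j v → anc v w ≡ true
    anc-intro {v} {w} Yw walk =
      let i , le , walk' = short-walk (λ _ → proj₁) (Yw , ≤-refl) walk
      in ∧-join Yw (walk⇒ball le (walk-map (λ _ p → ∧-join (proj₁ p) (≤ᵇ-true (proj₂ p))) walk'))

    anc-elim : ∀ {v w} → anc v w ≡ true → Y w ≡ true × Σ[ j ∈ ℕ ] Walk (adj G) (Above w) w j v
    anc-elim {v} {w} p =
      let Yw , b = ∧-split p
          j , _ , walk = ball⇒walk (λ x → Y x ∧ (L w ≤ᵇ L x)) (2 ^ q) b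
      in Yw , j , walk-map (λ x r → let Yx , le = ∧-split {Y x} r in Yx , true-≤ᵇ {L w} le) walk

    -- Walking from `x` to `v` and on to `y` never goes below level `L x`: the ancestors of a vertex
    -- form a chain.
    anc-join : ∀ {v x y} → anc v x ≡ true → anc v y ≡ true → L x ≤ L y →
      Σ[ j ∈ ℕ ] Walk (adj G) (Above x) x j y
    anc-join p q x≤y =
      let Yx , i , w = anc-elim p
          Yy , j , w' = anc-elim q
      in i + j , walk-++ w (walk-reverse (adjSym G) (Yy , x≤y) (walk-map (λ _ (Yz , le) → Yz , ≤-trans x≤y le) w'))

    -- The forest property: a walk from `x` to the common ancestor `w` can be continued to `v` as
    -- well as to `u`.
    anc-prefix : ∀ {u v w x} → anc u w ≡ true → anc v w ≡ true → L x ≤ L w → anc u x ≡ true → anc v x ≡ true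
    anc-prefix p q x≤w r =
      let _ , w₁ = anc-join r p x≤w
          _ , _ , w₂ = anc-elim q
      in anc-intro (proj₁ (anc-elim r)) (walk-++ w₁ (walk-map (λ _ (Yz , le) → Yz , ≤-trans x≤w le) w₂))

    anc-colors-differ : ∀ {v x y} → anc v x ≡ true → anc v y ≡ true → L x < L y → χ x ≢ χ y
    anc-colors-differ p q x<y =
      let Yx = proj₁ (anc-elim p)
          _ , w = anc-join p q (<⇒≤ x<y)
          i , le , w' = short-walk (λ _ → proj₁) (Yx , ≤-refl) w
      in distinct (≤-trans le 2^q≤K) x<y (walk-map (λ _ → proj₂) (walk-reverse (adjSym G) (Yx , ≤-refl) w'))

    -- Of two ancestors one is weakly reachable from the other, so their colours under `χ` differ,
    -- and all these colours are among the `q` chosen.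
    anc-small : ∀ v → countFin (anc v) ≤ q
    anc-small v = countFin-upper (anc v) (λ x p → proj₁ (color x p)) same
      where
      color : ∀ x → anc v x ≡ true → Σ[ j ∈ Fin q ] eqFin (cols j) (χ x) ≡ true
      color x p = anyFin-elim (λ j → eqFin (cols j) (χ x)) (proj₁ (anc-elim p))
      same : ∀ x y p p' → proj₁ (color x p) ≡ proj₁ (color y p') → x ≡ y
      same x y p p' eq with <-cmp (L x) (L y)
      ... | tri≈ _ e _  = L-inj e
      ... | tri< lt _ _ = ⊥-elim (anc-colors-differ p p' lt (trans (sym (eqFin⇒≡ (proj₂ (color x p))))
                            (trans (cong cols eq) (eqFin⇒≡ (proj₂ (color y p'))))))
      ... | tri> _ _ gt = ⊥-elim (anc-colors-differ p' p gt (trans (sym (eqFin⇒≡ (proj₂ (color y p'))))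
                            (trans (cong cols (sym eq)) (eqFin⇒≡ (proj₂ (color x p))))))

    -- The ancestor set as a bit sequence indexed by `L`; injectivity of `L` makes it lossless.
    bit : Fin (size G) → ℕ → Bool
    bit v i = anyFin (λ w → anc v w ∧ ((L w ≤ᵇ i) ∧ (i ≤ᵇ L w)))

    bit-intro : ∀ {v w} → anc v w ≡ true → bit v (L w) ≡ true
    bit-intro {v} {w} p = anyFin-intro (λ x → anc v x ∧ ((L x ≤ᵇ L w) ∧ (L w ≤ᵇ L x))) w
      (∧-join p (∧-join (≤ᵇ-true {L w} ≤-refl) (≤ᵇ-true {L w} ≤-refl)))

    bit-elim : ∀ {v i} → bit v i ≡ true → Σ[ w ∈ Fin (size G) ] (anc v w ≡ true × L w ≡ i)
    bit-elim {v} {i} p =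
      let w , r = anyFin-elim (λ w → anc v w ∧ ((L w ≤ᵇ i) ∧ (i ≤ᵇ L w))) p
          a , s = ∧-split {anc v w} r
          le , ge = ∧-split {L w ≤ᵇ i} s
      in w , a , ≤-antisym (true-≤ᵇ {L w} le) (true-≤ᵇ {i} ge)

-- Sorting by the binary number whose leading bits are the smallest ancestors lists an
-- elimination forest in preorder.

code : (ℕ → Bool) → ℕ → ℕ
code β zero    = 0
code β (suc i) = ind (β i) + 2 * code β i

-- Bit 0 is the most significant, so `code β i` is a leading part of `code β h`, and a deficit in a
-- leading part cannot be made up by later bits.
code-mono : ∀ β γ {i h} → i ≤ h → code β h ≤ code γ h → code β i ≤ code γ i
code-mono β γ {h = zero} z≤n le = le
code-mono β γ {i} {suc h} i≤h le with m≤n⇒m<n∨m≡n i≤h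
... | inj₂ refl = le
... | inj₁ i<h  = code-mono β γ (≤-pred i<h) (≮⇒≥ (λ lt → <⇒≱ (drop lt) le))
  where
  open ≤-Reasoning
  ind≤1 : ∀ b → ind b ≤ 1
  ind≤1 true  = ≤-refl
  ind≤1 false = z≤n
  drop : code γ h < code β h → code γ (suc h) < code β (suc h)
  drop lt = begin-strict
    ind (γ h) + 2 * code γ h   ≤⟨ +-monoˡ-≤ (2 * code γ h) (ind≤1 (γ h)) ⟩
    1 + 2 * code γ h           <⟨ ≤-refl ⟩
    2 + 2 * code γ h           ≡⟨ sym (*-suc 2 (code γ h)) ⟩
    2 * suc (code γ h)         ≤⟨ *-monoʳ-≤ 2 lt ⟩
    2 * code β h               ≤⟨ m≤n+m _ (ind (β h)) ⟩
    ind (β h) + 2 * code β h ∎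

code-cong : ∀ β γ h → (∀ i → i < h → β i ≡ γ i) → code β h ≡ code γ h
code-cong β γ zero    _  = refl
code-cong β γ (suc h) eq = cong₂ (λ b x → ind b + 2 * x) (eq h ≤-refl) (code-cong β γ h (λ i lt → eq i (m≤n⇒m≤1+n lt)))

-- The leading parts of `γ` of lengths `m` and `suc m` are squeezed between equal ones of `β` and
-- `δ`; comparing the two lengths isolates bit `m`.
code-between : ∀ β γ δ {m h} → m < h → code β h ≤ code γ h → code γ h ≤ code δ h →
  (∀ i → i ≤ m → β i ≡ δ i) → β m ≡ γ m
code-between β γ δ {m} {h} m<h β≤γ γ≤δ eq = ind-injective (β m) (γ m)
  (+-cancelʳ-≡ (2 * code β m) _ _ (trans (squeeze (suc m) m<h (λ i lt → eq i (≤-pred lt)))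
    (cong (λ x → ind (γ m) + 2 * x) (sym (squeeze m (<⇒≤ m<h) (λ i lt → eq i (<⇒≤ lt)))))))
  where
  squeeze : ∀ i → i ≤ h → (∀ j → j < i → β j ≡ δ j) → code β i ≡ code γ i
  squeeze i i≤h agree = ≤-antisym (code-mono β γ i≤h β≤γ)
    (≤-trans (code-mono γ δ i≤h γ≤δ) (≤-reflexive (sym (code-cong β δ i agree))))
  ind-injective : ∀ a b → ind a ≡ ind b → a ≡ b
  ind-injective true  true  _ = refl
  ind-injective false false _ = refl

module _ {G : Graph} {K c : ℕ} (col : WeakColoring G K c) (q : ℕ) (2^q≤K : 2 ^ q ≤ K) (cols : Fin q → Fin c) where
  open WeakColoring col
  open Union col q 2^q≤K cols

  key : Fin (size G) → ℕ
  key v = code (bit v) height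

  -- Up to level `L w` the vertices `u` and `v` have the same ancestors, so their keys begin alike,
  -- and a key between them must begin in the same way. Thus subtrees are intervals of the order.
  anc-between : ∀ {u v w x} → anc u w ≡ true → anc v w ≡ true → key u ≤ key x → key x ≤ key v → anc x w ≡ true
  anc-between {u} {v} {w} {x} p q u≤x x≤v =
    let w' , r , eq = bit-elim {x} (trans (sym bit≡) (bit-intro p))
    in subst (λ z → anc x z ≡ true) (L-inj eq) r
    where
    agree : ∀ {u v} → anc u w ≡ true → anc v w ≡ true → ∀ i → i ≤ L w → bit u i ≡ true → bit v i ≡ true
    agree {u} {v} p q i le b with bit-elim {u} b
    ... | y , r , refl = bit-intro (anc-prefix p q le r)
    bit≡ : bit u (L w) ≡ bit x (L w)
    bit≡ = code-between (bit u) (bit x) (bit v) (L<height w) u≤x x≤v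
      (λ i le → Bool-ext (agree p q i le) (agree q p i le))

  -- The minimum of the walk is an ancestor of both ends, hence of every vertex whose key lies
  -- between them.
  separate : ∀ {u v x j} → Y u ≡ true → Walk (adj G) (λ z → Y z ≡ true) u j v →
    (key u ≤ key x × key x ≤ key v) ⊎ (key v ≤ key x × key x ≤ key u) →
    Σ[ w ∈ Fin (size G) ] Σ[ i₁ ∈ ℕ ] Σ[ i₂ ∈ ℕ ]
      (anc x w ≡ true × i₁ + i₂ ≡ j × Walk (adj G) Anywhere u i₁ w × Walk (adj G) Anywhere w i₂ v)
  separate {u} {v} {x} Yu walk between = min , i₁ , i₂ , anc-x between , lengths ,
      walk-map (λ _ _ → tt) to-min , walk-map (λ _ _ → tt) from-min
    where
    open MinSplit (min-split L Yu walk)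
    anc-u : anc u min ≡ true
    anc-u = anc-intro min-P (walk-reverse (adjSym G) (Yu , min≤start) to-min)
    anc-v : anc v min ≡ true
    anc-v = anc-intro min-P from-min
    anc-x : _ → anc x min ≡ true
    anc-x (inj₁ (p , q)) = anc-between anc-u anc-v p q
    anc-x (inj₂ (p , q)) = anc-between anc-v anc-u p q

-- Shortest-path closures and distance types

-- A walk is stored for each length bound `j` separately, so exchanging a walk for the stored one
-- never exceeds the length at hand.
record Route (G : Graph) (r : ℕ) (u h : Fin (size G)) (j : ℕ) : Set where
  field
    stop  : Fin r → Fin (size G)
    route : ∀ {i} → i ≤ j → Walk (adj G) Anywhere u i h →
            Σ[ i ∈ ℕ ] (i ≤ j × Walk (adj G) (λ x → Σ[ s ∈ Fin r ] stop s ≡ x) u i h)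

exists-route : ∀ G r u h j → j ≤ r → Route G r u h j
exists-route G r u h j j≤r with true-or-false (ball {A = adj G} (λ _ → true) j u h)
... | inj₂ none = record
  { stop = λ _ → u
  ; route = λ le w → ⊥-elim (true≢false (walk⇒ball {P = λ _ → true} le (walk-map (λ _ _ → refl) w)) none) }
... | inj₁ b =
  let i , le , w = ball⇒walk (λ _ → true) j b
      stop , onto = cover (visited w) (≤-trans (countFin-visited w) (≤-trans le j≤r)) u
  in record { stop = stop ; route = λ _ _ → i , le , walk-map onto (walk-in-visited w) }

-- `u` itself, and for each of `w` hubs and `suc r` length bounds the at most `r` further vertices
-- of a stored walk.
closureSize : ℕ → ℕ → ℕ
closureSize r w = suc (w * (suc r * r))

module _ {G : Graph} {r w : ℕ} (R : WeakReach G r w) where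
  open WeakReach R

  private
    route : ∀ u (e : Fin w) (j : Fin (suc r)) → Route G r u (hub u e) (toℕ j)
    route u e j = exists-route G r u (hub u e) (toℕ j) (Fin.toℕ≤pred[n] j)

    stopAt : Fin (size G) → Fin w × Fin (suc r) × Fin r → Fin (size G)
    stopAt u (e , j , s) = Route.stop (route u e j) s

    decode : Fin (w * (suc r * r)) → Fin w × Fin (suc r) × Fin r
    decode i = proj₁ (remQuot {w} (suc r * r) i) , remQuot {suc r} r (proj₂ (remQuot {w} (suc r * r) i))

    decode-combine : ∀ e j s → decode (combine e (combine j s)) ≡ (e , j , s)
    decode-combine e j s =
      trans (cong (λ p → proj₁ p , remQuot {suc r} r (proj₂ p)) (Fin.remQuot-combine {w} {suc r * r} e (combine j s)))
            (cong (e ,_) (Fin.remQuot-combine {suc r} {r} j s))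

  near : Fin (size G) → Fin (closureSize r w) → Fin (size G)
  near u zero    = u
  near u (suc i) = stopAt u (decode i)

  private
    stop∈near : ∀ u e j s → Σ[ i ∈ Fin (closureSize r w) ] near u i ≡ Route.stop (route u e j) s
    stop∈near u e j s = suc (combine e (combine j s)) , cong (stopAt u) (decode-combine e j s)

    to-hub : ∀ {u y i} → i ≤ r → L y ≤ L u → Walk (adj G) (λ x → ⊤ × L y ≤ L x) u i y →
      Σ[ j ∈ ℕ ] (j ≤ i × Walk (adj G) (λ x → Σ[ s ∈ Fin (closureSize r w) ] near u s ≡ x) u j y)
    to-hub {u} {y} {i} i≤r y≤u walk with covers i≤r y≤u (walk-map (λ _ → proj₂) walk)
    ... | e , refl =
      let i≡ = Fin.toℕ-fromℕ< (s≤s i≤r)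
          j , j≤ , walk' = Route.route (route u e (fromℕ< (s≤s i≤r))) (≤-reflexive (sym i≡)) (walk-map (λ _ _ → tt) walk)
      in j , ≤-trans j≤ (≤-reflexive i≡) ,
         walk-map (λ x (s , eq) → let t , eq' = stop∈near u e (fromℕ< (s≤s i≤r)) s in t , trans eq' eq) walk'

  -- The minimum of the walk is a hub of both ends; each half is exchanged for a stored route to it
  -- that is no longer.
  closure-walk : ∀ {u v j} {Y : Fin (size G) → Set} → (∀ i → Y (near u i)) → (∀ i → Y (near v i)) → j ≤ r →
    Walk (adj G) Anywhere u j v → Σ[ i ∈ ℕ ] (i ≤ j × Walk (adj G) Y u i v)
  closure-walk {u} {v} {j} {Y} Yu Yv j≤r walk =
    let a , a≤ , w₁ = to-hub (≤-trans i₁≤ j≤r) min≤start to-min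
        b , b≤ , w₂ = to-hub (≤-trans i₂≤ j≤r) (proj₂ (walk-end (tt , ≤-refl) from-min))
                        (walk-reverse (adjSym G) (tt , ≤-refl) from-min)
    in a + b , ≤-trans (+-mono-≤ a≤ b≤) (≤-reflexive lengths) ,
       walk-++ (walk-map (λ { _ (i , refl) → Yu i }) w₁)
               -- `near v zero` is `v`: after reversal the former start `v` is a vertex to be
               -- checked.
               (walk-reverse (adjSym G) (Yv zero) (walk-map (λ { _ (i , refl) → Yv i }) w₂))
    where
    open MinSplit (min-split {A = adj G} {P = Anywhere} L tt walk)
    i₁≤ : i₁ ≤ j
    i₁≤ = ≤-trans (m≤m+n i₁ i₂) (≤-reflexive lengths)
    i₂≤ : i₂ ≤ j
    i₂≤ = ≤-trans (m≤n+m i₂ i₁) (≤-reflexive lengths)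

bool→Fin : Bool → Fin 2
bool→Fin false = zero
bool→Fin true  = suc zero

bool→Fin-injective : ∀ a b → bool→Fin a ≡ bool→Fin b → a ≡ b
bool→Fin-injective true  true  _ = refl
bool→Fin-injective false false _ = refl

-- One bit for each of `q` separating vertices and each distance bound from 0 to `r`; vertices
-- farther apart than `r` have only false bits.
typeCount : ℕ → ℕ → ℕ
typeCount r q = 2 ^ (q * suc r)

distanceType : ∀ (G : Graph) r {q} → (Fin q → Fin (size G)) → Fin (size G) → Fin (typeCount r q)
distanceType G r {q} s u = funToFin {q * suc r} (λ i →
  let a , k = remQuot {q} (suc r) i in bool→Fin (reach (adj G) (toℕ k) u (s a)))

distanceType-reach : ∀ G r {q} (s : Fin q → Fin (size G)) u u' → distanceType G r s u ≡ distanceType G r s u' →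
  ∀ a {k} → k ≤ r → reach (adj G) k u (s a) ≡ reach (adj G) k u' (s a)
distanceType-reach G r {q} s u u' eq a {k} k≤r = bool→Fin-injective _ _
  (trans (sym (value u)) (trans (cong (λ t → finToFun t i) eq) (value u')))
  where
  i : Fin (q * suc r)
  i = combine a (fromℕ< (s≤s k≤r))
  value : ∀ u → finToFun (distanceType G r s u) i ≡ bool→Fin (reach (adj G) k u (s a))
  value u = trans (Fin.finToFun-funToFin {q * suc r} {2} _ i)
    (trans (cong (λ p → bool→Fin (reach (adj G) (toℕ (proj₂ p)) u (s (proj₁ p)))) (Fin.remQuot-combine {q} {suc r} a (fromℕ< (s≤s k≤r))))
           (cong (λ z → bool→Fin (reach (adj G) z u (s a))) (Fin.toℕ-fromℕ< (s≤s k≤r))))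

Between : ∀ {A : Set} → (A → ℕ) → A → A → A → Set
Between κ u x v = (κ u ≤ κ x × κ x ≤ κ v) ⊎ (κ v ≤ κ x × κ x ≤ κ u)

walk⇒power-adj : ∀ G {r u v j} → u ≢ v → j ≤ r → Walk (adj G) Anywhere u j v → adj (power r G) u v ≡ true
walk⇒power-adj G u≢v le w = ∧-join (false⇒not-true (≢⇒eqFin u≢v)) (∨-inl (walk⇒reach le w))

power-adj⇒walk : ∀ G {r u v} → adj (power r G) u v ≡ true → Σ[ j ∈ ℕ ] (j ≤ r × Walk (adj G) Anywhere u j v)
power-adj⇒walk G {r} {u} {v} p with ∨-split (proj₂ (∧-split {not (eqFin u v)} p))
... | inj₁ q = reach⇒walk r q
... | inj₂ q = let j , le , w = reach⇒walk r q in j , le , walk-reverse (adjSym G) tt w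

module _ {G : Graph} {r w : ℕ} (R : WeakReach G r w)
         {K c : ℕ} (col : WeakColoring G K c) (q : ℕ) (2^q≤K : 2 ^ q ≤ K) (cols : Fin q → Fin c) where
  open Union col q 2^q≤K cols

  Closed : Fin (size G) → Set
  Closed u = ∀ i → Y (near R u i) ≡ true

  separator : Fin (size G) → Fin q → Fin (size G)
  separator x = proj₁ (cover (anc x) (anc-small x) x)

  -- A connection of `u` and `v` of length at most `r` can be taken inside `Y`, so it passes a
  -- separating vertex `z`. Equal types bring `u'` to `z` in no more steps than the walk from `u`
  -- takes, and the rest of the walk is reused.
  sameType⇒sameAdj : ∀ {u u' v} x → Closed u → Closed v → u' ≢ v →
    Between (key col q 2^q≤K cols) u x v →
    distanceType G r (separator x) u ≡ distanceType G r (separator x) u' →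
    adj (power r G) u v ≡ true → adj (power r G) u' v ≡ true
  sameType⇒sameAdj {u} {u'} {v} x Cu Cv u'≢v between eq p =
    let j , j≤r , walk₀ = power-adj⇒walk G p
        i , i≤j , walk = closure-walk R {Y = λ z → Y z ≡ true} Cu Cv j≤r walk₀
        z , i₁ , i₂ , anc-z , i₁+i₂≡i , w₁ , w₂ = separate col q 2^q≤K cols {x = x} (Cu zero) walk between
        a , sep-a = proj₂ (cover (anc x) (anc-small x) x) z anc-z
        i₁+i₂≤r = ≤-trans (≤-reflexive i₁+i₂≡i) (≤-trans i≤j j≤r)
        i₁≤r = ≤-trans (m≤m+n i₁ i₂) i₁+i₂≤r
        reach-u = subst (λ y → reach (adj G) i₁ u y ≡ true) (sym sep-a) (walk⇒reach ≤-refl w₁)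
        reach-u' = subst (λ y → reach (adj G) i₁ u' y ≡ true) sep-a
                     (trans (sym (distanceType-reach G r (separator x) u u' eq a i₁≤r)) reach-u)
        k , k≤i₁ , w₃ = reach⇒walk i₁ reach-u'
    in walk⇒power-adj G u'≢v (≤-trans (+-monoˡ-≤ i₂ k≤i₁) i₁+i₂≤r) (walk-++ w₃ w₂)

-- Cut-rank

eqFin-suc : ∀ {n} (i j : Fin n) → eqFin (suc i) (suc j) ≡ eqFin i j
eqFin-suc i j = Bool-ext (λ p → ≡⇒eqFin (Fin.suc-injective (eqFin⇒≡ p))) (λ p → ≡⇒eqFin (cong suc (eqFin⇒≡ p)))

xorSum-cong : ∀ {n} {f g : Fin n → Bool} → (∀ i → f i ≡ g i) → xorSum f ≡ xorSum g
xorSum-cong {zero}  p = refl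
xorSum-cong {suc n} p = cong₂ _xor_ (p zero) (xorSum-cong (p ∘ suc))

xorSum-xor : ∀ {n} (f g : Fin n → Bool) → xorSum (λ i → f i xor g i) ≡ xorSum f xor xorSum g
xorSum-xor {zero}  f g = refl
xorSum-xor {suc n} f g = trans (cong ((f zero xor g zero) xor_) (xorSum-xor (f ∘ suc) (g ∘ suc)))
  (interchange (f zero) (g zero) (xorSum (f ∘ suc)) (xorSum (g ∘ suc)))
  where
  interchange : ∀ a b c d → (a xor b) xor (c xor d) ≡ (a xor c) xor (b xor d)
  interchange true  true  true  true  = refl
  interchange true  true  true  false = refl
  interchange true  true  false true  = refl
  interchange true  true  false false = refl
  interchange true  false true  true  = refl
  interchange true  false true  false = refl
  interchange true  false false true  = refl
  interchange true  false false false = refl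
  interchange false true  true  true  = refl
  interchange false true  true  false = refl
  interchange false true  false true  = refl
  interchange false true  false false = refl
  interchange false false c     d     = refl

xorSum-false : ∀ n → xorSum {n} (λ _ → false) ≡ false
xorSum-false zero    = refl
xorSum-false (suc n) = xorSum-false n

xorSum-single : ∀ {n} i (g : Fin n → Bool) → xorSum (λ x → eqFin i x ∧ g x) ≡ g i
xorSum-single {suc n} zero g = trans (cong (g zero xor_) (xorSum-false n)) (Bool.xor-identityʳ (g zero))
xorSum-single {suc n} (suc i) g = trans
  (xorSum-cong (λ x → cong (_∧ g (suc x)) (eqFin-suc i x)))
  (xorSum-single i (g ∘ suc))

-- Among more than `t` rows two have the same type; they agree in every column, so their sum over
-- the binary field vanishes.
cutRank≤types : ∀ (G : Graph) (X : Fin (size G) → Set) {t} (τ : Fin (size G) → Fin t) →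
  (∀ u u' v → X u → X u' → ¬ X v → τ u ≡ τ u' → adj G u v ≡ adj G u' v) → CutRankLe G X t
cutRank≤types G X {t} τ same m rows rows∈X indep with m ≤? t
... | yes le = le
... | no nle with Fin.pigeonhole (≰⇒> nle) (τ ∘ rows)
...   | i , j , i<j , eq = ⊥-elim (true≢false cᵢ (indep c vanish i))
  where
  c : Fin m → Bool
  c x = eqFin i x xor eqFin j x
  cᵢ : c i ≡ true
  cᵢ = cong₂ _xor_ (eqFin-refl i) (≢⇒eqFin (λ j≡i → Fin.<⇒≢ i<j (sym j≡i)))
  vanish : ∀ y → ¬ X y → xorSum (λ x → c x ∧ adj G (rows x) y) ≡ false
  vanish y y∉X = begin
    xorSum (λ x → c x ∧ a x)
      ≡⟨ xorSum-cong (λ x → Bool.∧-distribʳ-xor (a x) (eqFin i x) (eqFin j x)) ⟩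
    xorSum (λ x → (eqFin i x ∧ a x) xor (eqFin j x ∧ a x))
      ≡⟨ xorSum-xor (λ x → eqFin i x ∧ a x) (λ x → eqFin j x ∧ a x) ⟩
    xorSum (λ x → eqFin i x ∧ a x) xor xorSum (λ x → eqFin j x ∧ a x)
      ≡⟨ cong₂ _xor_ (xorSum-single i a) (xorSum-single j a) ⟩
    a i xor a j
      ≡⟨ cong (_xor a j) (same (rows i) (rows j) y (rows∈X i) (rows∈X j) y∉X eq) ⟩
    a j xor a j
      ≡⟨ Bool.xor-same (a j) ⟩
    false ∎
    where
    open ≡-Reasoning
    a : Fin m → Bool
    a x = adj G (rows x) y

-- Sorting

argminFin : ∀ {m} (κ : Fin (suc m) → ℕ) → Σ[ j ∈ Fin (suc m) ] (∀ i → κ j ≤ κ i)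
argminFin {zero}  κ = zero , λ { zero → ≤-refl }
argminFin {suc m} κ with argminFin (κ ∘ suc)
... | j , min with ≤-total (κ zero) (κ (suc j))
...   | inj₁ le = zero , λ { zero → ≤-refl ; (suc i) → ≤-trans le (min i) }
...   | inj₂ ge = suc j , λ { zero → ge ; (suc i) → min i }

record Sorting {m} (κ : Fin m → ℕ) : Set where
  field
    pos at : Fin m → Fin m
    at-pos : ∀ v → at (pos v) ≡ v
    at-inj : ∀ {i j} → at i ≡ at j → i ≡ j
    sorted : ∀ i j → toℕ i ≤ toℕ j → κ (at i) ≤ κ (at j)

  pos-at : ∀ i → pos (at i) ≡ i
  pos-at i = at-inj (at-pos (at i))

sort : ∀ {m} (κ : Fin m → ℕ) → Sorting κ
sort {zero} κ = record { pos = λ () ; at = λ () ; at-pos = λ () ; at-inj = λ { {()} } ; sorted = λ () }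
sort {suc m} κ with argminFin κ
... | j , min = record { pos = pos ; at = at ; at-pos = at-pos ; at-inj = at-inj ; sorted = sorted }
  where
  module R = Sorting (sort (κ ∘ punchIn j))
  at pos : Fin (suc m) → Fin (suc m)
  at zero    = j
  at (suc i) = punchIn j (R.at i)
  pos v with j ≟ v
  ... | yes _  = zero
  ... | no j≢v = suc (R.pos (punchOut j≢v))
  at-pos : ∀ v → at (pos v) ≡ v
  at-pos v with j ≟ v
  ... | yes eq = eq
  ... | no j≢v = trans (cong (punchIn j) (R.at-pos _)) (Fin.punchIn-punchOut j≢v)
  at-inj : ∀ {x y} → at x ≡ at y → x ≡ y
  at-inj {zero}  {zero}  _ = refl
  at-inj {zero}  {suc y} p = ⊥-elim (Fin.punchInᵢ≢i j _ (sym p))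
  at-inj {suc x} {zero}  p = ⊥-elim (Fin.punchInᵢ≢i j _ p)
  at-inj {suc x} {suc y} p = cong suc (R.at-inj (Fin.punchIn-injective j _ _ p))
  sorted : ∀ x y → toℕ x ≤ toℕ y → κ (at x) ≤ κ (at y)
  sorted zero    y       _        = min (at y)
  sorted (suc x) (suc y) (s≤s le) = R.sorted x y le

-- Caterpillars

cong-suc² : ∀ {n} {x y : Fin n} → x ≡ y → _≡_ {A = Fin (2 + n)} (suc (suc x)) (suc (suc y))
cong-suc² refl = refl

isOne : ∀ {n} → Fin (2 + n) → Bool
isOne (suc zero) = true
isOne _          = false

isOne⇒≡ : ∀ {n} {x : Fin (2 + n)} → isOne x ≡ true → x ≡ suc zero
isOne⇒≡ {x = suc zero} _ = refl

countFin-isOne : ∀ n → countFin {2 + n} isOne ≡ 1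
countFin-isOne n = cong suc (countFin-∅ {U = λ (_ : Fin n) → false} (λ _ → refl))

-- The caterpillar with 2 + k leaves arises from the one with 1 + k leaves by attaching
-- the new leaves 0 and 1 to the old leaf 1, which becomes 3.
catAdj : ∀ k → Rel (2 + k * 2)
catAdj zero    zero          zero          = false
catAdj zero    zero          (suc zero)    = true
catAdj zero    (suc zero)    zero          = true
catAdj zero    (suc zero)    (suc zero)    = false
catAdj (suc k) zero          zero          = false
catAdj (suc k) zero          (suc zero)    = false
catAdj (suc k) zero          (suc (suc y)) = isOne y
catAdj (suc k) (suc zero)    zero          = false
catAdj (suc k) (suc zero)    (suc zero)    = false
catAdj (suc k) (suc zero)    (suc (suc y)) = isOne y
catAdj (suc k) (suc (suc x)) zero          = isOne x
catAdj (suc k) (suc (suc x)) (suc zero)    = isOne x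
catAdj (suc k) (suc (suc x)) (suc (suc y)) = catAdj k x y

catAdj-sym : ∀ k x y → catAdj k x y ≡ catAdj k y x
catAdj-sym zero    zero          zero          = refl
catAdj-sym zero    zero          (suc zero)    = refl
catAdj-sym zero    (suc zero)    zero          = refl
catAdj-sym zero    (suc zero)    (suc zero)    = refl
catAdj-sym (suc k) zero          zero          = refl
catAdj-sym (suc k) zero          (suc zero)    = refl
catAdj-sym (suc k) zero          (suc (suc y)) = refl
catAdj-sym (suc k) (suc zero)    zero          = refl
catAdj-sym (suc k) (suc zero)    (suc zero)    = refl
catAdj-sym (suc k) (suc zero)    (suc (suc y)) = refl
catAdj-sym (suc k) (suc (suc x)) zero          = refl
catAdj-sym (suc k) (suc (suc x)) (suc zero)    = refl
catAdj-sym (suc k) (suc (suc x)) (suc (suc y)) = catAdj-sym k x y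

catAdj-irrefl : ∀ k x → catAdj k x x ≡ false
catAdj-irrefl zero    zero          = refl
catAdj-irrefl zero    (suc zero)    = refl
catAdj-irrefl (suc k) zero          = refl
catAdj-irrefl (suc k) (suc zero)    = refl
catAdj-irrefl (suc k) (suc (suc x)) = catAdj-irrefl k x

caterpillar : ℕ → Graph
caterpillar k = record
  { size = 2 + k * 2 ; adj = catAdj k ; adjSym = catAdj-sym k ; irrefl = catAdj-irrefl k }

degree-one : ∀ k → degree (caterpillar k) (suc zero) ≡ 1
degree-one zero    = refl
degree-one (suc k) = countFin-isOne (k * 2)

caterpillar-cubic : ∀ k t → degree (caterpillar k) t ≡ 1 ⊎ degree (caterpillar k) t ≡ 3
caterpillar-cubic zero    zero                      = inj₁ refl
caterpillar-cubic zero    (suc zero)                = inj₁ refl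
caterpillar-cubic (suc k) zero                      = inj₁ (countFin-isOne (k * 2))
caterpillar-cubic (suc k) (suc zero)                = inj₁ (countFin-isOne (k * 2))
caterpillar-cubic (suc k) (suc (suc zero))          = caterpillar-cubic k zero
caterpillar-cubic (suc k) (suc (suc (suc zero)))    = inj₂ (cong (2 +_) (degree-one k))
caterpillar-cubic (suc k) (suc (suc (suc (suc x)))) = caterpillar-cubic k (suc (suc x))

-- The order starts with the two newest leaves. Leaf `zero` of the smaller caterpillar is skipped,
-- because its node has become an inner one.
leaf : ∀ k → Fin (2 + k) → Fin (2 + k * 2)
leaf k       zero          = suc zero
leaf k       (suc zero)    = zero
leaf (suc k) (suc (suc i)) = suc (suc (leaf k (suc i)))

isOne-leaf : ∀ k i → isOne (leaf k (suc i)) ≡ false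
isOne-leaf k       zero    = refl
isOne-leaf (suc k) (suc i) = refl

leaf-injective : ∀ k i j → leaf k i ≡ leaf k j → i ≡ j
leaf-injective k       zero          zero          _ = refl
leaf-injective k       (suc zero)    (suc zero)    _ = refl
leaf-injective (suc k) zero          (suc (suc j)) ()
leaf-injective (suc k) (suc zero)    (suc (suc j)) ()
leaf-injective (suc k) (suc (suc i)) (suc zero)    ()
leaf-injective (suc k) (suc (suc i)) zero          ()
leaf-injective (suc k) (suc (suc i)) (suc (suc j)) p =
  cong suc (leaf-injective k (suc i) (suc j) (Fin.suc-injective (Fin.suc-injective p)))

leaf-degree : ∀ k i → degree (caterpillar k) (leaf k i) ≡ 1
leaf-degree k       zero          = degree-one k
leaf-degree zero    (suc zero)    = refl
leaf-degree (suc k) (suc zero)    = countFin-isOne (k * 2)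
leaf-degree (suc k) (suc (suc i)) rewrite isOne-leaf k i = leaf-degree k (suc i)

leaf-onto : ∀ k t → degree (caterpillar k) t ≡ 1 → Σ[ i ∈ Fin (2 + k) ] leaf k i ≡ t
leaf-onto k       zero       _ = suc zero , refl
leaf-onto k       (suc zero) _ = zero , refl
leaf-onto (suc k) (suc (suc zero)) p with leaf-onto k zero p
... | suc i , eq = suc (suc i) , cong-suc² eq
leaf-onto (suc k) (suc (suc (suc (suc x)))) p with leaf-onto k (suc (suc x)) p
... | suc i , eq = suc (suc i) , cong-suc² eq

lift : ∀ {k P Q u j v} → (∀ x → P x → Q (suc (suc x))) → Walk (catAdj k) P u j v →
  Walk (catAdj (suc k)) Q (suc (suc u)) j (suc (suc v))
lift f here         = here
lift f (step w a p) = step (lift f w) a (f _ p)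

walk-from-one : ∀ k t → Σ[ j ∈ ℕ ] Walk (catAdj k) Anywhere (suc zero) j t
walk-from-one zero    zero          = 1 , step here refl tt
walk-from-one zero    (suc zero)    = 0 , here
walk-from-one (suc k) zero          = 2 , step (step {y = suc (suc (suc zero))} here refl tt) refl tt
walk-from-one (suc k) (suc zero)    = 0 , here
walk-from-one (suc k) (suc (suc t)) =
  let j , w = walk-from-one k t in suc j , walk-cons refl tt (lift (λ _ _ → tt) w)

caterpillar-connected : ∀ k → Connected (caterpillar k)
caterpillar-connected k u v =
  let i , w = walk-from-one k u
      j , w' = walk-from-one k v
  in i + j , walk⇒reach ≤-refl (walk-++ (walk-reverse (catAdj-sym k) tt w) w')

-- Numbers increase towards the last node as root, so a larger neighbour is the parent.
catAdj-up-unique : ∀ k a {b c} → catAdj k a b ≡ true → catAdj k a c ≡ true →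
  toℕ a < toℕ b → toℕ a < toℕ c → b ≡ c
catAdj-up-unique zero    zero          {suc zero}    {suc zero}    _ _ _ _ = refl
catAdj-up-unique zero    (suc zero)    {suc zero}    {_}           _ _ (s≤s ()) _
catAdj-up-unique (suc k) zero          {suc (suc b)} {suc (suc c)} p q _ _ =
  cong-suc² (trans (isOne⇒≡ p) (sym (isOne⇒≡ q)))
catAdj-up-unique (suc k) (suc zero)    {suc (suc b)} {suc (suc c)} p q _ _ =
  cong-suc² (trans (isOne⇒≡ p) (sym (isOne⇒≡ q)))
catAdj-up-unique (suc k) (suc (suc a)) {suc zero}    {_}           _ _ (s≤s ()) _
catAdj-up-unique (suc k) (suc (suc a)) {suc (suc b)} {suc zero}    _ _ _ (s≤s ())
catAdj-up-unique (suc k) (suc (suc a)) {suc (suc b)} {suc (suc c)} p q (s≤s (s≤s r)) (s≤s (s≤s s)) =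
  cong-suc² (catAdj-up-unique k a p q r s)

cycle-neighbours : ∀ (T : Graph) {k} (f : Fin (3 + k) → Fin (size T)) → IsCycle T f → ∀ i →
  Σ[ a ∈ Fin (3 + k) ] Σ[ b ∈ Fin (3 + k) ] (a ≢ b × adj T (f i) (f a) ≡ true × adj T (f i) (f b) ≡ true)
cycle-neighbours T {k} f (_ , next , close) zero =
  suc zero , fromℕ (2 + k) , (λ ()) , next zero , trans (adjSym T _ _) close
cycle-neighbours T {k} f (_ , next , close) (suc i) with 2 + k ℕ.≟ toℕ (suc i)
... | yes last = inject₁ i , zero , prev≢zero , trans (adjSym T _ _) (next i) ,
    subst (λ x → adj T (f x) (f zero) ≡ true) (Fin.toℕ-injective (trans (Fin.toℕ-fromℕ (2 + k)) last)) close
  where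
  prev≢zero : inject₁ i ≢ zero
  prev≢zero p = 1+n≢0 (trans (suc-injective last) (trans (sym (Fin.toℕ-inject₁ i)) (cong toℕ p)))
... | no ¬last = inject₁ i , suc j , prev≢next , trans (adjSym T _ _) (next i) ,
    subst (λ x → adj T (f x) (f (suc j)) ≡ true) (Fin.inject₁-lower₁ (suc i) ¬last) (next j)
  where
  j = lower₁ (suc i) ¬last
  prev≢next : inject₁ i ≢ suc j
  prev≢next p = <⇒≢ (m≤n⇒m≤1+n ≤-refl) (trans (sym (Fin.toℕ-inject₁ i))
    (trans (cong toℕ p) (cong suc (trans (sym (Fin.toℕ-inject₁ j)) (cong toℕ (Fin.inject₁-lower₁ (suc i) ¬last))))))

-- The least node of a cycle would have two larger neighbours.
caterpillar-acyclic : ∀ k → Acyclic (caterpillar k)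
caterpillar-acyclic k l f cycle@(f-inj , _) with argminFin (toℕ ∘ f)
... | i , min with cycle-neighbours (caterpillar k) f cycle i
...   | a , b , a≢b , p , q = a≢b (f-inj a b (catAdj-up-unique k (f i) p q (above p) (above q)))
  where
  above : ∀ {x} → catAdj k (f i) (f x) ≡ true → toℕ (f i) < toℕ (f x)
  above {x} p = ≤∧≢⇒< (min x) (λ eq →
    true≢false p (trans (cong (catAdj k (f i)) (sym (Fin.toℕ-injective eq))) (catAdj-irrefl k (f i))))

-- The nodes in the subtree at a, for the tree rooted at its last node.
below : ∀ k → Rel (2 + k * 2)
below zero    zero          zero          = true
below zero    zero          (suc zero)    = false
below zero    (suc zero)    _             = true
below (suc k) zero          zero          = true
below (suc k) zero          (suc _)       = false
below (suc k) (suc zero)    zero          = false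
below (suc k) (suc zero)    (suc zero)    = true
below (suc k) (suc zero)    (suc (suc _)) = false
below (suc k) (suc (suc a)) zero          = below k a (suc zero)
below (suc k) (suc (suc a)) (suc zero)    = below k a (suc zero)
below (suc k) (suc (suc a)) (suc (suc t)) = below k a t

-- `S` is the component of `a` once the edge is deleted. Connectivity of the other side is included
-- so that the cut can be read from `b` as well.
record EdgeCut (T : Graph) (S : Fin (size T) → Bool) (a b : Fin (size T)) : Set where
  field
    in-a    : S a ≡ true
    out-b   : S b ≡ false
    cross   : ∀ t t' → S t ≡ true → S t' ≡ false → adj T t t' ≡ true → t ≡ a × t' ≡ b
    from-a  : ∀ t → S t ≡ true → Σ[ j ∈ ℕ ] Walk (adj T) (λ x → S x ≡ true) a j t
    from-b  : ∀ t → S t ≡ false → Σ[ j ∈ ℕ ] Walk (adj T) (λ x → S x ≡ false) b j t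

EdgeCut-flip : ∀ {T S a b} → EdgeCut T S a b → EdgeCut T (not ∘ S) b a
EdgeCut-flip {T} {S} cut = record
  { in-a = cong not out-b
  ; out-b = cong not in-a
  ; cross = λ t t' p q e → let x , y = cross t' t (not-false⇒true q) (not-true⇒false p) (trans (adjSym T t' t) e) in y , x
  ; from-a = λ t p → let j , w = from-b t (not-true⇒false p) in j , walk-map (λ _ → cong not) w
  ; from-b = λ t p → let j , w = from-a t (not-false⇒true p) in j , walk-map (λ _ → cong not) w }
  where
  open EdgeCut cut
  not-false⇒true : ∀ {x} → not x ≡ false → x ≡ true
  not-false⇒true {true} _ = refl

-- The two new leaves hang from the old leaf 1 and join its side, so a cut of the smaller
-- caterpillar extends to the larger one.
below-cut : ∀ k a b → catAdj k a b ≡ true → toℕ a < toℕ b → EdgeCut (caterpillar k) (below k a) a b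
below-cut zero zero (suc zero) _ _ = record
  { in-a = refl ; out-b = refl
  ; cross = λ { zero (suc zero) _ _ _ → refl , refl ; (suc zero) _ () _ _ ; zero zero _ () _ }
  ; from-a = λ { zero _ → 0 , here ; (suc zero) () }
  ; from-b = λ { (suc zero) _ → 0 , here ; zero () } }
below-cut zero (suc zero) (suc zero) _ (s≤s ())
below-cut (suc k) zero (suc (suc b)) e _ with isOne⇒≡ {x = b} e
... | refl = record
  { in-a = refl ; out-b = refl
  ; cross = λ { zero (suc (suc y)) _ _ p → refl , cong-suc² (isOne⇒≡ p) ; zero zero _ () _ ; zero (suc zero) _ _ () ; (suc _) _ () _ _ }
  ; from-a = λ { zero _ → 0 , here ; (suc _) () }
  ; from-b = λ { (suc zero) _ → 1 , step here refl refl
               ; (suc (suc t)) _ → let j , w = walk-from-one k t in j , lift (λ _ _ → refl) w } }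
below-cut (suc k) (suc zero) (suc zero) _ (s≤s ())
below-cut (suc k) (suc zero) (suc (suc b)) e _ with isOne⇒≡ {x = b} e
... | refl = record
  { in-a = refl ; out-b = refl
  ; cross = λ { (suc zero) (suc (suc y)) _ _ p → refl , cong-suc² (isOne⇒≡ p) ; (suc zero) zero _ _ () ; (suc zero) (suc zero) _ () _
              ; zero _ () _ _ ; (suc (suc _)) _ () _ _ }
  ; from-a = λ { (suc zero) _ → 0 , here ; zero () ; (suc (suc _)) () }
  ; from-b = λ { zero _ → 1 , step here refl refl
               ; (suc (suc t)) _ → let j , w = walk-from-one k t in j , lift (λ _ _ → refl) w } }
below-cut (suc k) (suc (suc a)) (suc zero) _ (s≤s ())
below-cut (suc k) (suc (suc a)) (suc (suc b)) e (s≤s (s≤s a<b)) = record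
  { in-a = in-a ; out-b = out-b ; cross = cross' ; from-a = from-a' ; from-b = from-b' }
  where
  open EdgeCut (below-cut k a b e a<b)
  S : Fin (4 + k * 2) → Bool
  S = below (suc k) (suc (suc a))
  below-one : ∀ {y} → isOne y ≡ true → below k a y ≡ below k a (suc zero)
  below-one p = cong (below k a) (isOne⇒≡ p)
  cross' : ∀ t t' → S t ≡ true → S t' ≡ false → catAdj (suc k) t t' ≡ true → t ≡ suc (suc a) × t' ≡ suc (suc b)
  cross' zero          (suc (suc y)) p q r = ⊥-elim (true≢false p (trans (sym (below-one r)) q))
  cross' (suc zero)    (suc (suc y)) p q r = ⊥-elim (true≢false p (trans (sym (below-one r)) q))
  cross' (suc (suc x)) zero          p q r = ⊥-elim (true≢false (trans (sym (below-one r)) p) q)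
  cross' (suc (suc x)) (suc zero)    p q r = ⊥-elim (true≢false (trans (sym (below-one r)) p) q)
  cross' (suc (suc x)) (suc (suc y)) p q r =
    let u , v = cross x y p q r in cong-suc² u , cong-suc² v
  from-a' : ∀ t → S t ≡ true → Σ[ j ∈ ℕ ] Walk (catAdj (suc k)) (λ x → S x ≡ true) (suc (suc a)) j t
  from-a' zero          p = let j , w = from-a (suc zero) p in suc j , step (lift (λ _ q → q) w) refl p
  from-a' (suc zero)    p = let j , w = from-a (suc zero) p in suc j , step (lift (λ _ q → q) w) refl p
  from-a' (suc (suc t)) p = let j , w = from-a t p in j , lift (λ _ q → q) w
  from-b' : ∀ t → S t ≡ false → Σ[ j ∈ ℕ ] Walk (catAdj (suc k)) (λ x → S x ≡ false) (suc (suc b)) j t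
  from-b' zero          p = let j , w = from-b (suc zero) p in suc j , step (lift (λ _ q → q) w) refl p
  from-b' (suc zero)    p = let j , w = from-b (suc zero) p in suc j , step (lift (λ _ q → q) w) refl p
  from-b' (suc (suc t)) p = let j , w = from-b t p in j , lift (λ _ q → q) w

-- Growing the caterpillar splits the first leaf of the order in two. An initial segment gains one
-- position, a later single leaf is shifted, and the first leaf alone becomes the segment of the
-- first two.
below-leaves : ∀ k a →
  (Σ[ i ∈ Fin (2 + k) ] (∀ j → below k a (leaf k j) ≡ eqFin i j)) ⊎
  (Σ[ i ∈ Fin (2 + k) ] (∀ j → below k a (leaf k j) ≡ (toℕ j ≤ᵇ toℕ i)))
below-leaves zero    zero       = inj₁ (suc zero , λ { zero → refl ; (suc zero) → refl })
below-leaves zero    (suc zero) = inj₂ (suc zero , λ { zero → refl ; (suc zero) → refl })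
below-leaves (suc k) zero       = inj₁ (suc zero , λ { zero → refl ; (suc zero) → refl ; (suc (suc j)) → refl })
below-leaves (suc k) (suc zero) = inj₂ (zero , λ { zero → refl ; (suc zero) → refl ; (suc (suc j)) → refl })
below-leaves (suc k) (suc (suc a)) with below-leaves k a
... | inj₁ (zero , h)  = inj₂ (suc zero , λ { zero → h zero ; (suc zero) → h zero ; (suc (suc j)) → h (suc j) })
... | inj₁ (suc i , h) = inj₁ (suc (suc i) , λ
  { zero → h zero ; (suc zero) → h zero ; (suc (suc j)) → trans (h (suc j)) (sym (eqFin-suc (suc i) (suc j))) })
... | inj₂ (i , h)     = inj₂ (suc i , λ { zero → h zero ; (suc zero) → h zero ; (suc (suc j)) → h (suc j) })

-- Sides of a deleted edge and the width of a leaf order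

module _ {T : Graph} {S : Fin (size T) → Bool} {a b : Fin (size T)} (cut : EdgeCut T S a b) where
  open EdgeCut cut

  deleteEdge-sound : ∀ {j t} → Walk (deleteEdge T a b) Anywhere a j t → S t ≡ true
  deleteEdge-sound here = in-a
  deleteEdge-sound (step {x = x} {y} w e _) with true-or-false (S y)
  ... | inj₁ Sy = Sy
  ... | inj₂ ¬Sy with ∧-split {adj T x y} e
  ...   | e' , keep with cross x y (deleteEdge-sound w) ¬Sy e'
  ...     | x≡a , y≡b = ⊥-elim (true≢false {(eqFin x a ∧ eqFin y b) ∨ (eqFin x b ∧ eqFin y a)}
                          (∨-inl (∧-join (≡⇒eqFin x≡a) (≡⇒eqFin y≡b))) (not-true⇒false keep))

  deleteEdge-complete : ∀ {j t} → Walk (adj T) (λ x → S x ≡ true) a j t → Walk (deleteEdge T a b) Anywhere a j t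
  deleteEdge-complete here = here
  deleteEdge-complete (step {x = x} {y} w e Sy) =
    step (deleteEdge-complete w) (∧-join e (false⇒not-true (¬true⇒false removed))) tt
    where
    Sx : S x ≡ true
    Sx = walk-end {P = λ z → S z ≡ true} in-a w
    removed : ¬ ((eqFin x a ∧ eqFin y b) ∨ (eqFin x b ∧ eqFin y a) ≡ true)
    removed p with ∨-split {eqFin x a ∧ eqFin y b} p
    ... | inj₁ q = true≢false Sy (trans (cong S (eqFin⇒≡ (proj₂ (∧-split {eqFin x a} q)))) out-b)
    ... | inj₂ q = true≢false Sx (trans (cong S (eqFin⇒≡ (proj₁ (∧-split {eqFin x b} q)))) out-b)

module _ (G : Graph) (D : RankDecomposition G) {S : Fin (size (tree D)) → Bool} {a b : Fin (size (tree D))}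
         (cut : EdgeCut (tree D) S a b) where

  side⇒S : ∀ {x} → sideOf D a b x → S (leafMap D x) ≡ true
  side⇒S (k , p) = let j , _ , w = reach⇒walk k p in deleteEdge-sound cut w

  ¬side⇒¬S : ∀ {x} → ¬ sideOf D a b x → S (leafMap D x) ≡ false
  ¬side⇒¬S ¬side = ¬true⇒false (λ p →
    let j , w = EdgeCut.from-a cut _ p in ¬side (j , walk⇒reach ≤-refl (deleteEdge-complete cut w)))

cutRank-mono : ∀ {G X s t} → s ≤ t → CutRankLe G X s → CutRankLe G X t
cutRank-mono le h m rows p q = ≤-trans (h m rows p q) le

-- Each edge cuts off a single leaf or an initial segment of the order. A single row has rank at
-- most 1, a single column allows two kinds of rows, and a segment ending in `at i` allows the `t`
-- types relative to `at i`; `2 + t` covers all cases.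
rankWidth≤types : ∀ (H : Graph) {t} (κ : Fin (size H) → ℕ) (τ : Fin (size H) → Fin (size H) → Fin t) →
  (∀ x u u' v → u ≢ v → u' ≢ v → Between κ u x v → Between κ u' x v → τ x u ≡ τ x u' → adj H u v ≡ adj H u' v) →
  RankWidthLe H (2 + t)
rankWidth≤types record { size = zero }        κ τ same = inj₁ z≤n
rankWidth≤types record { size = suc zero }    κ τ same = inj₁ ≤-refl
rankWidth≤types H@(record { size = suc (suc k) }) {t} κ τ same = inj₂ (D , width)
  where
  open Sorting (sort κ)
  D : RankDecomposition H
  D = record
    { tree = caterpillar k
    ; isTree = caterpillar-connected k , caterpillar-acyclic k
    ; twoNodes = s≤s (s≤s z≤n)
    ; cubic = caterpillar-cubic k
    ; leafMap = leaf k ∘ pos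
    ; leafInj = λ x y p → trans (sym (at-pos x)) (trans (cong at (leaf-injective k _ _ p)) (at-pos y))
    ; toLeaf = leaf-degree k ∘ pos
    ; leafOnto = λ s p → let i , eq = leaf-onto k s p in at i , trans (cong (leaf k) (pos-at i)) eq }
  at≡ : ∀ {i u} → eqFin i (pos u) ≡ true → u ≡ at i
  at≡ p = trans (sym (at-pos _)) (cong at (sym (eqFin⇒≡ p)))
  κ≤ : ∀ {i u} → (toℕ (pos u) ≤ᵇ toℕ i) ≡ true → κ u ≤ κ (at i)
  κ≤ {i} {u} p = subst (λ z → κ z ≤ κ (at i)) (at-pos u) (sorted (pos u) i (true-≤ᵇ {toℕ (pos u)} p))
  κ≥ : ∀ {i u} → (toℕ (pos u) ≤ᵇ toℕ i) ≡ false → κ (at i) ≤ κ u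
  κ≥ {i} {u} p = subst (λ z → κ (at i) ≤ κ z) (at-pos u)
    (sorted i (pos u) (≮⇒≥ (λ lt → true≢false (≤ᵇ-true (<⇒≤ lt)) p)))
  up-width : ∀ a b → catAdj k a b ≡ true → toℕ a < toℕ b → CutRankLe H (sideOf D a b) (2 + t)
  up-width a b e a<b with below-leaves k a
  ... | inj₁ (i , h) = cutRank-mono {H} {sideOf D a b} (s≤s z≤n) (cutRank≤types H (sideOf D a b) {1} (λ _ → zero)
    (λ u u' v p p' q _ → cong (λ z → adj H z v) (trans (is-at p) (sym (is-at p')))))
    where
    cut = below-cut k a b e a<b
    is-at : ∀ {u} → sideOf D a b u → u ≡ at i
    is-at p = at≡ (trans (sym (h _)) (side⇒S H D cut p))
  ... | inj₂ (i , h) = cutRank-mono {H} {sideOf D a b} (m≤n+m t 2) (cutRank≤types H (sideOf D a b) (τ (at i))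
    (λ u u' v p p' q → same (at i) u u' v (λ { refl → q p }) (λ { refl → q p' })
      (inj₁ (low p , high q)) (inj₁ (low p' , high q))))
    where
    cut = below-cut k a b e a<b
    low : ∀ {u} → sideOf D a b u → κ u ≤ κ (at i)
    low p = κ≤ (trans (sym (h _)) (side⇒S H D cut p))
    high : ∀ {u} → ¬ sideOf D a b u → κ (at i) ≤ κ u
    high q = κ≥ (trans (sym (h _)) (¬side⇒¬S H D cut q))
  down-width : ∀ a b → catAdj k a b ≡ true → toℕ a < toℕ b → CutRankLe H (sideOf D b a) (2 + t)
  down-width a b e a<b with below-leaves k a
  ... | inj₁ (i , h) = cutRank-mono {H} {sideOf D b a} (m≤m+n 2 t) (cutRank≤types H (sideOf D b a)
    (λ u → bool→Fin (adj H u (at i)))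
    (λ u u' v p p' q eq → subst (λ z → adj H u z ≡ adj H u' z) (sym (is-at q)) (bool→Fin-injective _ _ eq)))
    where
    cut = EdgeCut-flip (below-cut k a b e a<b)
    is-at : ∀ {u} → ¬ sideOf D b a u → u ≡ at i
    is-at {u} q = at≡ (trans (sym (h _)) (trans (sym (Bool.not-involutive (below k a (leaf k (pos u)))))
      (cong not (¬side⇒¬S H D cut q))))
  ... | inj₂ (i , h) = cutRank-mono {H} {sideOf D b a} (m≤n+m t 2) (cutRank≤types H (sideOf D b a) (τ (at i))
    (λ u u' v p p' q → same (at i) u u' v (λ { refl → q p }) (λ { refl → q p' })
      (inj₂ (low q , high p)) (inj₂ (low q , high p'))))
    where
    cut = EdgeCut-flip (below-cut k a b e a<b)
    high : ∀ {u} → sideOf D b a u → κ (at i) ≤ κ u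
    high p = κ≥ (trans (sym (h _)) (not-true⇒false (side⇒S H D cut p)))
    low : ∀ {u} → ¬ sideOf D b a u → κ u ≤ κ (at i)
    low {u} q = κ≤ (trans (sym (h _)) (trans (sym (Bool.not-involutive (below k a (leaf k (pos u)))))
      (cong not (¬side⇒¬S H D cut q))))
  width : WidthLe D (2 + t)
  width a b e with <-cmp (toℕ a) (toℕ b)
  ... | tri< lt _ _ = up-width a b e lt
  ... | tri> _ _ gt = down-width b a (trans (catAdj-sym k b a) e) gt
  ... | tri≈ _ eq _ = ⊥-elim (true≢false e
    (trans (cong (catAdj k a) (sym (Fin.toℕ-injective eq))) (catAdj-irrefl k a)))

-- Colourings of powers

module _ (count : ℕ → ℕ) where

  productCount : ℕ → ℕ
  productCount zero    = count 0
  productCount (suc p) = productCount p * count (suc p)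

  module _ {A : Set} (f : ∀ i → A → Fin (count i)) where

    product : ∀ p → A → Fin (productCount p)
    product zero    v = f 0 v
    product (suc p) v = combine (product p v) (f (suc p) v)

    product-project : ∀ p i → i ≤ p →
      Σ[ π ∈ (Fin (productCount p) → Fin (count i)) ] (∀ v → π (product p v) ≡ f i v)
    product-project zero zero z≤n = id , λ _ → refl
    product-project (suc p) i i≤ with m≤n⇒m<n∨m≡n i≤
    ... | inj₂ refl = proj₂ ∘ remQuot {productCount p} (count (suc p)) ,
                      λ v → cong proj₂ (Fin.remQuot-combine (product p v) (f (suc p) v))
    ... | inj₁ i<   = let π , h = product-project p i (≤-pred i<)
                      in π ∘ proj₁ ∘ remQuot {productCount p} (count (suc p)) ,
                         λ v → trans (cong (π ∘ proj₁) (Fin.remQuot-combine (product p v) (f (suc p) v))) (h v)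

UnionsHaveRankWidth : (r : ℕ) (G : Graph) (p {N} bound : ℕ) → (Fin (size G) → Fin N) → Set
UnionsHaveRankWidth r G p {N} bound col = ∀ (cs : Fin p → Fin N) (H : Graph) (emb : Fin (size H) → Fin (size G)) →
  (∀ u v → emb u ≡ emb v → u ≡ v) → (∀ u v → adj H u v ≡ adj (power r G) (emb u) (emb v)) →
  (∀ u → Σ[ j ∈ Fin p ] cs j ≡ col (emb u)) → RankWidthLe H bound

module _ {G : Graph} {r w : ℕ} (R : WeakReach G r w) (p : ℕ) {c : ℕ} where

  private
    D q : ℕ
    D = closureSize r w
    q = p * D

  module _ (weak : WeakColoring G (2 ^ q) c) where
    open WeakColoring weak using (χ)

    closureColor : Fin (size G) → Fin (c ^ D)
    closureColor u = funToFin {D} {c} (λ e → χ (near R u e))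

    -- Each class fixes the `D` colours of a closure, so decoding the `p` classes yields `q = p * D`
    -- colours of `χ` whose union contains the closure of every vertex of `H`.
    closureColor-unions : UnionsHaveRankWidth r G p (2 + typeCount r q) closureColor
    closureColor-unions cs H emb emb-inj emb-adj inClasses = rankWidth≤types H
      (key weak q ≤-refl cols ∘ emb)
      (λ x u → distanceType G r (separator R weak q ≤-refl cols (emb x)) (emb u))
      (λ x u u' v u≢v u'≢v between between' eq → trans (emb-adj u v) (trans (Bool-ext
        (sameType⇒sameAdj R weak q ≤-refl cols (emb x) (closed u) (closed v) (u'≢v ∘ emb-inj u' v) between eq)
        (sameType⇒sameAdj R weak q ≤-refl cols (emb x) (closed u') (closed v) (u≢v ∘ emb-inj u v) between' (sym eq)))
        (sym (emb-adj u' v))))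
      where
      colAt : Fin p × Fin D → Fin c
      colAt (j , e) = finToFun {c} {D} (cs j) e
      cols : Fin q → Fin c
      cols i = colAt (remQuot {p} D i)
      closed : ∀ u → Closed R weak q ≤-refl cols (emb u)
      closed u e = let j , eq = inClasses u in anyFin-intro (λ i → eqFin (cols i) (χ (near R (emb u) e))) (combine j e)
        (≡⇒eqFin (trans (cong colAt (Fin.remQuot-combine {p} {D} j e))
          (trans (cong (λ z → finToFun {c} {D} z e) eq) (Fin.finToFun-funToFin {D} {c} (λ e → χ (near R (emb u) e)) e))))

module _ {C : Graph → Set} (be : BoundedExpansion C) (r : ℕ) where

  private
    D : ℕ
    D = closureSize r (weakColoringNumber be r)

  -- The base is the number of greedy colours for distance `2 ^ (p * D)`, one more than the hubs
  -- there; the exponent is the number of vertices whose colours are recorded.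
  colorCount rankBound : ℕ → ℕ
  colorCount p = suc (weakColoringNumber be (2 ^ (p * D))) ^ D
  rankBound  p = 2 + typeCount r (p * D)

  exists-coloring : ∀ p {G} → C G →
    Σ[ col ∈ (Fin (size G) → Fin (colorCount p)) ] UnionsHaveRankWidth r G p (rankBound p) col
  exists-coloring p CG =
    let R    = weakReach-bounded be r CG
        weak = weakColoring (weakReach-bounded be (2 ^ (p * D)) CG)
    in closureColor R p weak , closureColor-unions R p weak

lowRankWidthColorings : ∀ {C : Graph → Set} {r} (count bound : ℕ → ℕ) →
  (∀ p {G} → C G → Σ[ col ∈ (Fin (size G) → Fin (count p)) ] UnionsHaveRankWidth r G p (bound p) col) →
  LowRankWidthColorings (Powers r C)
lowRankWidthColorings {C} {r} count bound colorings = productCount count , bound , color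
  where
  color : ∀ p G → Powers r C G → Σ (Fin (size G) → Fin (productCount count p)) λ col →
    ∀ i → i ≤ p → ∀ (cs : Fin i → Fin (productCount count p)) → (∀ j j' → cs j ≡ cs j' → j ≡ j') →
    ∀ H → InducedBy G (λ v → Σ (Fin i) λ j → cs j ≡ col v) H → RankWidthLe H (bound i)
  color p _ (G , CG , refl) = product count (λ i → proj₁ (colorings i CG)) p , λ i i≤p cs _ H induced →
    let open InducedBy induced
        π , π-product = product-project count (λ i → proj₁ (colorings i CG)) p i i≤p
    in proj₂ (colorings i CG) (π ∘ cs) H emb embInj embAdj
         (λ u → let j , eq = embIn u in j , trans (cong π eq) (π-product (emb u)))

theorem2 : (C : Graph → Set) → BoundedExpansion C →
    (r : ℕ) → 2 ≤ r → LowRankWidthColorings (Powers r C)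
theorem2 C be r _ = lowRankWidthColorings (colorCount be r) (rankBound be r) (exists-coloring be r)
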